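{- Let $p\equiv 3\pmod 4$ be an odd prime. Let $A\geq C\geq 1$ and $B\geq D\geq 1$ be integers, and let $\alpha,\beta,\gamma,\delta$ be integers with $$1\leq\gamma\leq\alpha\leq p-1,\qquad 1\leq\delta\leq\beta\leq p-1.$$ Then $$\mathcal R(pA+\alpha,pB+\beta;pC+\gamma,pD+\delta)\equiv \mathcal R(A,B;C,D)\,\mathcal R(\alpha,\beta;\gamma,\delta)\binom{\alpha}{\gamma}^{D}\binom{\beta}{\delta}^{C}\pmod p.$$
   Context: For integers $A\geq C\geq 1$ and $B\geq D\geq 1$, the rectangular Gaussian binomial coefficient is the element of $\mathbb Q(i)$ $$\mathcal R(A,B;C,D):=\frac{\prod_{n=0}^{C-1}\prod_{m=0}^{D-1}\bigl(A+Bi-(n+mi)\bigr)}{\prod_{n=1}^{C}\prod_{m=1}^{D}(n+mi)}=\frac{\prod_{x=A-C+1}^{A}\prod_{y=B-D+1}^{B}(x+iy)}{\prod_{x=1}^{C}\prod_{y=1}^{D}(x+iy)}.$$ For a prime $p\equiv 3\pmod 4$, $\mathbb Q(i)$ is viewed inside $\mathbb Q_p(i)$, the unramified quadratic extension of $\mathbb Q_p$, whose ring of integers is $\mathbb Z_p[i]$. Congruences are interpreted locally: $X\equiv Y\pmod{p^r}$ means $X-Y\in p^r\mathbb Z_p[i]$. The symbols $\binom{\alpha}{\gamma},\binom{\beta}{\delta}$ are ordinary binomial coefficients. -}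

module Defs where

open import Data.Nat.Base as ℕ using (ℕ; zero; suc)
import Data.Nat.Properties as ℕ
import Data.Nat.Divisibility as ℕ
open import Data.Nat.Primality using (Prime; prime⇒nonTrivial)
open import Data.Integer.Base as ℤ using (ℤ; +_; 0ℤ)
import Data.Integer.Properties as ℤ
open import Data.Integer.Divisibility.Signed using (_∣_; divides; ∣⇒∣ᵤ; ∣m∣n⇒∣m+n; ∣m⇒∣m*n; ∣n⇒∣m*n)
open import Data.Integer.Tactic.RingSolver using (solve-∀)
open import Data.Rational.Base as ℚ using (ℚ; 0ℚ; ↥_; ↧_; ↧ₙ_)
import Data.Rational.Properties as ℚ
open import Data.Rational.Solver using (module +-*-Solver)
open import Data.Product.Base using (∃-syntax; _×_; _,_)
open import Relation.Nullary.Negation using (¬_)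
open import Relation.Binary.PropositionalEquality using (_≡_; refl; sym; subst)

-- Elements re + im·i, with coordinates in an arbitrary coefficient type.
record Gaussian (R : Set) : Set where
  constructor _+_𝐢
  field
    re im : R

open Gaussian public

mapᴳ : {R S : Set} → (R → S) → Gaussian R → Gaussian S
mapᴳ f (a + b 𝐢) = f a + f b 𝐢

ℚ[i] : Set
ℚ[i] = Gaussian ℚ

fromℕ : ℕ → ℚ[i]
fromℕ n = (+ n ℚ./ 1) + 0ℚ 𝐢

infix 8 _+i_

_+i_ : ℕ → ℕ → ℚ[i]
x +i y = (+ x ℚ./ 1) + (+ y ℚ./ 1) 𝐢

infixl 7 _·_ _÷_
infixl 6 _⊖_

_⊖_ : ℚ[i] → ℚ[i] → ℚ[i]
(a + b 𝐢) ⊖ (c + d 𝐢) = (a ℚ.- c) + (b ℚ.- d) 𝐢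

_·_ : ℚ[i] → ℚ[i] → ℚ[i]
(a + b 𝐢) · (c + d 𝐢) = (a ℚ.* c ℚ.- b ℚ.* d) + (a ℚ.* d ℚ.+ b ℚ.* c) 𝐢

norm : ℚ[i] → ℚ
norm (a + b 𝐢) = a ℚ.* a ℚ.+ b ℚ.* b

_⁻¹ : (z : ℚ[i]) .{{_ : ℚ.NonZero (norm z)}} → ℚ[i]
z@(a + b 𝐢) ⁻¹ = (a ℚ.* ℚ.1/ norm z) + (ℚ.- b ℚ.* ℚ.1/ norm z) 𝐢

_÷_ : (w z : ℚ[i]) .{{_ : ℚ.NonZero (norm z)}} → ℚ[i]
w ÷ z = w · z ⁻¹

∏ : ℕ → (ℕ → ℚ[i]) → ℚ[i]
∏ zero    f = fromℕ 1
∏ (suc n) f = ∏ n f · f n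

infix 5 ∏

syntax ∏ n (λ x → e) = ∏[ x < n ] e

norm-· : ∀ w z → norm (w · z) ≡ norm w ℚ.* norm z
norm-· (a + b 𝐢) (c + d 𝐢) = solve 4
  (λ a b c d →
    (a :* c :- b :* d) :* (a :* c :- b :* d) :+ (a :* d :+ b :* c) :* (a :* d :+ b :* c)
      := (a :* a :+ b :* b) :* (c :* c :+ d :* d))
  refl a b c d
  where open +-*-Solver

∏-norm-pos : ∀ n f → (∀ x → ℚ.Positive (norm (f x))) → ℚ.Positive (norm (∏ n f))
∏-norm-pos zero    f pos = _
∏-norm-pos (suc n) f pos = subst ℚ.Positive (sym (norm-· (∏ n f) (f n)))
  (ℚ.pos*pos⇒pos (norm (∏ n f)) {{∏-norm-pos n f pos}} (norm (f n)) {{pos n}})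

+i-norm-pos : ∀ x y → ℚ.Positive (norm (suc x +i suc y))
+i-norm-pos x y = ℚ.pos+pos⇒pos (a ℚ.* a) {{ℚ.pos*pos⇒pos a a}} (b ℚ.* b) {{ℚ.pos*pos⇒pos b b}}
  where
  a = + suc x ℚ./ 1
  b = + suc y ℚ./ 1
  instance
    a-pos : ℚ.Positive a
    a-pos = ℚ.normalize-pos (suc x) 1
    b-pos : ℚ.Positive b
    b-pos = ℚ.normalize-pos (suc y) 1

ℛ-numerator : (A B C D : ℕ) → ℚ[i]
ℛ-numerator A B C D = ∏[ n < C ] ∏[ m < D ] (A +i B ⊖ n +i m)

-- The indices are shifted: the factors are x + iy for 1 ≤ x ≤ C and 1 ≤ y ≤ D.
ℛ-denominator : (C D : ℕ) → ℚ[i]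
ℛ-denominator C D = ∏[ n < C ] ∏[ m < D ] (suc n +i suc m)

ℛ-denominator-nonZero : ∀ C D → ℚ.NonZero (norm (ℛ-denominator C D))
ℛ-denominator-nonZero C D = ℚ.pos⇒nonZero (norm (ℛ-denominator C D))
  {{∏-norm-pos C _ λ n → ∏-norm-pos D _ λ m → +i-norm-pos n m}}

-- Meaningful for C ≤ A and D ≤ B only.
ℛ : (A B C D : ℕ) → ℚ[i]
ℛ A B C D = _÷_ (ℛ-numerator A B C D) (ℛ-denominator C D) {{ℛ-denominator-nonZero C D}}

-- ℤₚ = lim ℤ/pᵏ, up to the setoid equality _≈_: an element is given by
-- integer representatives of its residues modulo pᵏ.

module Local (p : ℕ) where

  pow : ℕ → ℤ
  pow k = + (p ℕ.^ k)

  record ℤₚ : Set where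
    field
      residue  : ℕ → ℤ
      coherent : ∀ k → pow k ∣ residue (suc k) ℤ.- residue k

  open ℤₚ public

  infix 4 _≈_

  _≈_ : ℤₚ → ℤₚ → Set
  a ≈ b = ∀ k → pow k ∣ residue a k ℤ.- residue b k

  ι : ℤ → ℤₚ
  ι n .residue  _ = n
  ι n .coherent _ = divides 0ℤ (ℤ.+-inverseʳ n)

  infixl 7 _*ₚ_

  _*ₚ_ : ℤₚ → ℤₚ → ℤₚ
  (a *ₚ b) .residue  k = residue a k ℤ.* residue b k
  (a *ₚ b) .coherent k = subst (pow k ∣_)
    (sym (expand (residue a (suc k)) (residue b (suc k)) (residue a k) (residue b k)))
    (∣m∣n⇒∣m+n (∣m⇒∣m*n (residue b (suc k)) (coherent a k)) (∣n⇒∣m*n (residue a k) (coherent b k)))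
    where
    expand : ∀ a′ b′ a b →
      a′ ℤ.* b′ ℤ.- a ℤ.* b ≡ (a′ ℤ.- a) ℤ.* b′ ℤ.+ a ℤ.* (b′ ℤ.- b)
    expand = solve-∀

  -- Being nonzero is witnessed by a nonzero residue.
  Nonzero : ℤₚ → Set
  Nonzero a = ∃[ k ] ¬ (pow k ∣ residue a k)

  -- ℚₚ as the field of fractions of ℤₚ, up to _≃_.
  record ℚₚ : Set where
    field
      num         : ℤₚ
      den         : ℤₚ
      den-nonzero : Nonzero den

  open ℚₚ public

  infix 4 _≃_ _≃ᴳ_

  _≃_ : ℚₚ → ℚₚ → Set
  x ≃ y = num x *ₚ den y ≈ num y *ₚ den x

  ℤₚ[i] : Set
  ℤₚ[i] = Gaussian ℤₚ

  -- This is the unramified quadratic extension of ℚₚ when p ≡ 3 (mod 4).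
  ℚₚ[i] : Set
  ℚₚ[i] = Gaussian ℚₚ

  _≃ᴳ_ : ℚₚ[i] → ℚₚ[i] → Set
  x ≃ᴳ y = re x ≃ re y × im x ≃ im y

  module _ {{pr : Prime p}} where

    private
      instance
        p-nonTrivial : ℕ.NonTrivial p
        p-nonTrivial = prime⇒nonTrivial pr

      k<pᵏ : ∀ k → k ℕ.< p ℕ.^ k
      k<pᵏ zero    = ℕ.z<s
      k<pᵏ (suc k) = ℕ.≤-<-trans (k<pᵏ k)
        (ℕ.^-monoʳ-< p (ℕ.nonTrivial⇒n>1 p) (ℕ.n<1+n k))

    ι-nonzero : ∀ d .{{_ : ℕ.NonZero d}} → Nonzero (ι (+ d))
    ι-nonzero d = d , λ pᵈ∣d → ℕ.<⇒≱ (k<pᵏ d) (ℕ.∣⇒≤ (∣⇒∣ᵤ pᵈ∣d))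

    ℤₚ⇒ℚₚ : ℤₚ → ℚₚ
    ℤₚ⇒ℚₚ a .num         = a
    ℤₚ⇒ℚₚ a .den         = ι (+ 1)
    ℤₚ⇒ℚₚ a .den-nonzero = ι-nonzero 1

    ℚ⇒ℚₚ : ℚ → ℚₚ
    ℚ⇒ℚₚ q .num         = ι (↥ q)
    ℚ⇒ℚₚ q .den         = ι (↧ q)
    ℚ⇒ℚₚ q .den-nonzero = ι-nonzero (↧ₙ q)

    -- X ∈ ℚ(i) is viewed inside ℚₚ(i).
    _∈p^_ℤₚ[i] : ℚ[i] → ℕ → Set
    X ∈p^ r ℤₚ[i] = ∃[ z ] mapᴳ ℚ⇒ℚₚ X ≃ᴳ mapᴳ (λ a → ℤₚ⇒ℚₚ (ι (pow r) *ₚ a)) z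

infix 4 _≡_[mod_^_]

_≡_[mod_^_] : ℚ[i] → ℚ[i] → (p : ℕ) {{_ : Prime p}} → ℕ → Set
X ≡ Y [mod p ^ r ] = Local._∈p^_ℤₚ[i] p (X ⊖ Y) r

-- For p ≡ 3 (mod 4) the prime p is inert, so x + iy is divisible by p exactly
-- when both x and y are, and is a p-adic unit otherwise. Cut the rectangle of
-- factors x + iy into p × p blocks, strips of width p, and a corner. Each block
-- contains one multiple p(x′ + iy′) of p; these account for ℛ A B C D and a power
-- of p common to numerator and denominator. Modulo p the other factors of a block
-- have a constant product. For a line of length p one has ∏_x (x + iy) ≡ K y with K
-- constant, so the strips give powers of binomial coefficients, and the corner gives
-- ℛ α β γ δ. Since ℛ A B C D is p-integral, by the same decomposition and induction
-- on C, the congruence between the unit parts may be multiplied by it.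

module Submission where

open import Defs
open import Algebra.Bundles using (CommutativeRing)
import Algebra.Properties.CommutativeMonoid.Sum as Sum
open import Algebra.Structures using (IsCommutativeRing)
open import Data.Fin.Base using (Fin; toℕ; fromℕ<)
open import Data.Fin.Permutation using (permutation)
import Data.Fin.Properties as Fin
open import Data.Integer.Base as ℤ using (ℤ; +_; -[1+_]; 0ℤ; 1ℤ)
import Data.Integer.DivMod as ℤ
open import Data.Integer.Divisibility.Signed as ℤ using (_∣_; divides; _∣?_)
import Data.Integer.Properties as ℤ
open import Data.Integer.Tactic.RingSolver using () renaming (solve-∀ to solveℤ)
open import Data.Maybe.Base using (Maybe; just; nothing)
open import Data.Nat.Base as ℕ using (ℕ; zero; suc; _<_; _≤_; z≤n; s≤s; z<s; s<s)
open import Data.Nat.Combinatorics.Base using (_P′_) renaming (_C_ to _choose_)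
open import Data.Nat.Combinatorics.Specification using (nP′n≡n!; k!∣nP′k; nC′k≡n!/k![n-k]!; nCk≡n!/k![n-k]!)
open import Data.Nat.Coprimality as Coprimality using (Coprime)
import Data.Nat.Divisibility as ℕ
import Data.Nat.DivMod as ℕ
open import Data.Nat.GCD using (module Bézout)
open import Data.Nat.Induction using (<-rec)
open import Data.Nat.Primality using (Prime; prime⇒irreducible; prime⇒nonZero; prime⇒nonTrivial)
import Data.Nat.Properties as ℕ
open import Data.Nat.Tactic.RingSolver using () renaming (solve-∀ to solveℕ)
open import Data.Product.Base using (_,_; proj₁; proj₂; ∃-syntax; _×_)
open import Data.Rational.Base as ℚ using (ℚ; mkℚ; 0ℚ; 1ℚ; ↥_; ↧_)
import Data.Rational.Properties as ℚ
open import Data.Rational.Solver using (module +-*-Solver)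
import Data.Rational.Unnormalised.Base as ℚᵘ
open import Data.Sum.Base using (_⊎_; inj₁; inj₂)
open import Function.Base using (_∘_)
open import Level using (0ℓ)
open import Relation.Binary.Bundles using (Setoid)
open import Relation.Binary.PropositionalEquality
import Relation.Binary.Reasoning.Setoid as SetoidReasoning
open import Relation.Nullary.Decidable using (Dec; yes; no; _×-dec_)
open import Relation.Nullary.Negation.Core using (¬_; contradiction)
open import Tactic.RingSolver using (solve-∀)
open import Tactic.RingSolver.Core.AlmostCommutativeRing using (AlmostCommutativeRing; fromCommutativeRing)

-- The denominator of ℛ is itself a numerator, `N C D C D`, so one exact factorisation serves both:
-- the large numerator is P · N₀ · W and the large denominator P · M · V, with N₀ / M = ℛ A B C D.
-- The constants of blocks and lines enter W and V with equal exponents and are therefore never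
-- evaluated. What matters is that V and the small denominator are units modulo p, and inertness is
-- needed for that. The obstacle is that M may be divisible by p, so N₀ / M cannot be reduced modulo
-- p. It is cancelled exactly in ℚ(i) instead, once integrality has supplied a unit u with u N₀ = M
-- w. The difference X of the two sides then satisfies X m = p z with m, z in ℤ[i] and m a unit
-- modulo p. Congruences are thus handled in ℤ[i], with the quotient by p kept as data, and p-adic
-- numbers enter only when this last equation is solved: multiplying by the conjugate of m makes the
-- divisor a rational integer, so each coordinate is divided separately.

infixl 6 _⊕_
infixl 7 _⊛_
infix 8 ⊝_

-- The ring of Gaussian integers.

ℤ[i] : Set
ℤ[i] = Gaussian ℤ

_⊕_ _⊛_ : ℤ[i] → ℤ[i] → ℤ[i]
(a + b 𝐢) ⊕ (c + d 𝐢) = (a ℤ.+ c) + (b ℤ.+ d) 𝐢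
(a + b 𝐢) ⊛ (c + d 𝐢) = (a ℤ.* c ℤ.- b ℤ.* d) + (a ℤ.* d ℤ.+ b ℤ.* c) 𝐢

⊝_ : ℤ[i] → ℤ[i]
⊝ (a + b 𝐢) = (ℤ.- a) + (ℤ.- b) 𝐢

embed : ℤ → ℤ[i]
embed a = a + 0ℤ 𝐢

gaussian-isCommutativeRing : IsCommutativeRing _≡_ _⊕_ _⊛_ ⊝_ (embed 0ℤ) (embed 1ℤ)
gaussian-isCommutativeRing = record
  { isRing = record
    { +-isAbelianGroup = record
      { isGroup = record
        { isMonoid = record
          { isSemigroup = record
            { isMagma = record { isEquivalence = isEquivalence ; ∙-cong = cong₂ _⊕_ }
            ; assoc = λ { (a + b 𝐢) (c + d 𝐢) (e + f 𝐢) → cong₂ _+_𝐢 (ℤ.+-assoc a c e) (ℤ.+-assoc b d f) }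
            }
          ; identity = (λ { (a + b 𝐢) → cong₂ _+_𝐢 (ℤ.+-identityˡ a) (ℤ.+-identityˡ b) })
                     , (λ { (a + b 𝐢) → cong₂ _+_𝐢 (ℤ.+-identityʳ a) (ℤ.+-identityʳ b) })
          }
        ; inverse = (λ { (a + b 𝐢) → cong₂ _+_𝐢 (ℤ.+-inverseˡ a) (ℤ.+-inverseˡ b) })
                  , (λ { (a + b 𝐢) → cong₂ _+_𝐢 (ℤ.+-inverseʳ a) (ℤ.+-inverseʳ b) })
        ; ⁻¹-cong = cong ⊝_
        }
      ; comm = λ { (a + b 𝐢) (c + d 𝐢) → cong₂ _+_𝐢 (ℤ.+-comm a c) (ℤ.+-comm b d) }
      }
    ; *-cong = cong₂ _⊛_
    ; *-assoc = λ { (a + b 𝐢) (c + d 𝐢) (e + f 𝐢) → cong₂ _+_𝐢 (assoc-re a b c d e f) (assoc-im a b c d e f) }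
    ; *-identity = (λ { (a + b 𝐢) → cong₂ _+_𝐢 (idˡ-re a b) (idˡ-im a b) })
                 , (λ { (a + b 𝐢) → cong₂ _+_𝐢 (idʳ-re a b) (idʳ-im a b) })
    ; distrib = (λ { (a + b 𝐢) (c + d 𝐢) (e + f 𝐢) → cong₂ _+_𝐢 (distˡ-re a b c d e f) (distˡ-im a b c d e f) })
              , (λ { (a + b 𝐢) (c + d 𝐢) (e + f 𝐢) → cong₂ _+_𝐢 (distʳ-re a b c d e f) (distʳ-im a b c d e f) })
    }
  ; *-comm = λ { (a + b 𝐢) (c + d 𝐢) → cong₂ _+_𝐢 (comm-re a b c d) (comm-im a b c d) }
  }
  where
  open import Data.Integer.Base using (_+_; _*_; _-_)
  assoc-re : ∀ a b c d e f → (a * c - b * d) * e - (a * d + b * c) * f ≡ a * (c * e - d * f) - b * (c * f + d * e)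
  assoc-re = solveℤ
  assoc-im : ∀ a b c d e f → (a * c - b * d) * f + (a * d + b * c) * e ≡ a * (c * f + d * e) + b * (c * e - d * f)
  assoc-im = solveℤ
  idˡ-re : ∀ a b → 1ℤ * a - 0ℤ * b ≡ a
  idˡ-re = solveℤ
  idˡ-im : ∀ a b → 1ℤ * b + 0ℤ * a ≡ b
  idˡ-im = solveℤ
  idʳ-re : ∀ a b → a * 1ℤ - b * 0ℤ ≡ a
  idʳ-re = solveℤ
  idʳ-im : ∀ a b → a * 0ℤ + b * 1ℤ ≡ b
  idʳ-im = solveℤ
  distˡ-re : ∀ a b c d e f → a * (c + e) - b * (d + f) ≡ (a * c - b * d) + (a * e - b * f)
  distˡ-re = solveℤ
  distˡ-im : ∀ a b c d e f → a * (d + f) + b * (c + e) ≡ (a * d + b * c) + (a * f + b * e)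
  distˡ-im = solveℤ
  distʳ-re : ∀ a b c d e f → (c + e) * a - (d + f) * b ≡ (c * a - d * b) + (e * a - f * b)
  distʳ-re = solveℤ
  distʳ-im : ∀ a b c d e f → (c + e) * b + (d + f) * a ≡ (c * b + d * a) + (e * b + f * a)
  distʳ-im = solveℤ
  comm-re : ∀ a b c d → a * c - b * d ≡ c * a - d * b
  comm-re = solveℤ
  comm-im : ∀ a b c d → a * d + b * c ≡ c * b + d * a
  comm-im = solveℤ

gaussianRing : CommutativeRing 0ℓ 0ℓ
gaussianRing = record { isCommutativeRing = gaussian-isCommutativeRing }

module ℤ[i] = CommutativeRing gaussianRing

ℤ[i]-ring : AlmostCommutativeRing 0ℓ 0ℓ
ℤ[i]-ring = fromCommutativeRing gaussianRing 0≟
  where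
  0≟ : ∀ z → Maybe (embed 0ℤ ≡ z)
  0≟ ((+ 0) + (+ 0) 𝐢) = just refl
  0≟ _             = nothing

conj : ℤ[i] → ℤ[i]
conj (a + b 𝐢) = a + (ℤ.- b) 𝐢

embed-* : ∀ a b → embed (a ℤ.* b) ≡ embed a ⊛ embed b
embed-* a b = cong₂ _+_𝐢 (real a b) (imaginary a b)
  where
  real : ∀ a b → a ℤ.* b ≡ a ℤ.* b ℤ.- 0ℤ ℤ.* 0ℤ
  real = solveℤ
  imaginary : ∀ a b → 0ℤ ≡ a ℤ.* 0ℤ ℤ.+ 0ℤ ℤ.* b
  imaginary = solveℤ

embed-pos-* : ∀ m n → embed (+ (m ℕ.* n)) ≡ embed (+ m) ⊛ embed (+ n)
embed-pos-* m n = trans (cong embed (ℤ.pos-* m n)) (embed-* (+ m) (+ n))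

-- The ring ℚ(i) and the embedding of ℤ[i].

infixl 6 _⊞_

_⊞_ : ℚ[i] → ℚ[i] → ℚ[i]
(a + b 𝐢) ⊞ (c + d 𝐢) = (a ℚ.+ c) + (b ℚ.+ d) 𝐢

neg : ℚ[i] → ℚ[i]
neg (a + b 𝐢) = (ℚ.- a) + (ℚ.- b) 𝐢

ℚ[i]-isCommutativeRing : IsCommutativeRing _≡_ _⊞_ _·_ neg (0ℚ + 0ℚ 𝐢) (1ℚ + 0ℚ 𝐢)
ℚ[i]-isCommutativeRing = record
  { isRing = record
    { +-isAbelianGroup = record
      { isGroup = record
        { isMonoid = record
          { isSemigroup = record
            { isMagma = record { isEquivalence = isEquivalence ; ∙-cong = cong₂ _⊞_ }
            ; assoc = λ { (a + b 𝐢) (c + d 𝐢) (e + f 𝐢) → cong₂ _+_𝐢 (ℚ.+-assoc a c e) (ℚ.+-assoc b d f) }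
            }
          ; identity = (λ { (a + b 𝐢) → cong₂ _+_𝐢 (ℚ.+-identityˡ a) (ℚ.+-identityˡ b) })
                     , (λ { (a + b 𝐢) → cong₂ _+_𝐢 (ℚ.+-identityʳ a) (ℚ.+-identityʳ b) })
          }
        ; inverse = (λ { (a + b 𝐢) → cong₂ _+_𝐢 (ℚ.+-inverseˡ a) (ℚ.+-inverseˡ b) })
                  , (λ { (a + b 𝐢) → cong₂ _+_𝐢 (ℚ.+-inverseʳ a) (ℚ.+-inverseʳ b) })
        ; ⁻¹-cong = cong neg
        }
      ; comm = λ { (a + b 𝐢) (c + d 𝐢) → cong₂ _+_𝐢 (ℚ.+-comm a c) (ℚ.+-comm b d) }
      }
    ; *-cong = cong₂ _·_
    ; *-assoc = λ { (a + b 𝐢) (c + d 𝐢) (e + f 𝐢) → cong₂ _+_𝐢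
        (solve 6 (λ a b c d e f → (a :* c :- b :* d) :* e :- (a :* d :+ b :* c) :* f
                               := a :* (c :* e :- d :* f) :- b :* (c :* f :+ d :* e)) refl a b c d e f)
        (solve 6 (λ a b c d e f → (a :* c :- b :* d) :* f :+ (a :* d :+ b :* c) :* e
                               := a :* (c :* f :+ d :* e) :+ b :* (c :* e :- d :* f)) refl a b c d e f) }
    ; *-identity = (λ z → trans (comm (1ℚ + 0ℚ 𝐢) z) (identityʳ z)) , identityʳ
    ; distrib = distribˡ , λ z w v → trans (comm (w ⊞ v) z)
                  (trans (distribˡ z w v) (cong₂ _⊞_ (comm z w) (comm z v)))
    }
  ; *-comm = comm
  }
  where
  open +-*-Solver
  comm : ∀ z w → z · w ≡ w · z
  comm (a + b 𝐢) (c + d 𝐢) = cong₂ _+_𝐢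
    (cong₂ ℚ._-_ (ℚ.*-comm a c) (ℚ.*-comm b d))
    (trans (ℚ.+-comm (a ℚ.* d) (b ℚ.* c)) (cong₂ ℚ._+_ (ℚ.*-comm b c) (ℚ.*-comm a d)))
  identityʳ : ∀ z → z · (1ℚ + 0ℚ 𝐢) ≡ z
  identityʳ (a + b 𝐢) = cong₂ _+_𝐢
    (solve 2 (λ a b → a :* con 1ℚ :- b :* con 0ℚ := a) refl a b)
    (solve 2 (λ a b → a :* con 0ℚ :+ b :* con 1ℚ := b) refl a b)
  distribˡ : ∀ z w v → z · (w ⊞ v) ≡ z · w ⊞ z · v
  distribˡ (a + b 𝐢) (c + d 𝐢) (e + f 𝐢) = cong₂ _+_𝐢
    (solve 6 (λ a b c d e f → a :* (c :+ e) :- b :* (d :+ f)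
                           := (a :* c :- b :* d) :+ (a :* e :- b :* f)) refl a b c d e f)
    (solve 6 (λ a b c d e f → a :* (d :+ f) :+ b :* (c :+ e)
                           := (a :* d :+ b :* c) :+ (a :* f :+ b :* e)) refl a b c d e f)

ℚ[i]-ring : AlmostCommutativeRing 0ℓ 0ℓ
ℚ[i]-ring = fromCommutativeRing (record { isCommutativeRing = ℚ[i]-isCommutativeRing }) 0≟
  where
  0≟ : ∀ z → Maybe ((0ℚ + 0ℚ 𝐢) ≡ z)
  0≟ (a + b 𝐢) with 0ℚ ℚ.≟ a | 0ℚ ℚ.≟ b
  ... | yes refl | yes refl = just refl
  ... | _        | _        = nothing

module ℚ[i] = IsCommutativeRing ℚ[i]-isCommutativeRing

int : ℤ → ℚ
int n = n ℚ./ 1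

private
  -- `int n` is normalised through a gcd that is stuck for a variable n. This form has the literal
  -- denominator 1, so that sums and products of such fractions compute.
  reduced : ℤ → ℚ
  reduced n = mkℚ n 0 (Coprimality.sym (Coprimality.1-coprimeTo ℤ.∣ n ∣))

  int-reduced : ∀ n → int n ≡ reduced n
  int-reduced n = ℚ.↥p/↧p≡p (reduced n)

int-+ : ∀ m n → int (m ℤ.+ n) ≡ int m ℚ.+ int n
int-+ m n = begin
  int (m ℤ.+ n)                    ≡⟨ cong int (cong₂ ℤ._+_ (ℤ.*-identityʳ m) (ℤ.*-identityʳ n)) ⟨
  reduced m ℚ.+ reduced n          ≡⟨ cong₂ ℚ._+_ (int-reduced m) (int-reduced n) ⟨
  int m ℚ.+ int n                  ∎
  where open ≡-Reasoning

int-* : ∀ m n → int (m ℤ.* n) ≡ int m ℚ.* int n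
int-* m n = sym (cong₂ ℚ._*_ (int-reduced m) (int-reduced n))

int-neg : ∀ n → int (ℤ.- n) ≡ ℚ.- int n
int-neg n = begin
  int (ℤ.- n)       ≡⟨ int-reduced (ℤ.- n) ⟩
  reduced (ℤ.- n)   ≡⟨ reduced-neg n ⟩
  ℚ.- reduced n     ≡⟨ cong ℚ.-_ (int-reduced n) ⟨
  ℚ.- int n         ∎
  where
  open ≡-Reasoning
  reduced-neg : ∀ n → reduced (ℤ.- n) ≡ ℚ.- reduced n
  reduced-neg (+ zero)  = refl
  reduced-neg (+ suc n) = refl
  reduced-neg -[1+ n ]  = refl

int-minus : ∀ m n → int (m ℤ.- n) ≡ int m ℚ.- int n
int-minus m n = trans (int-+ m (ℤ.- n)) (cong (int m ℚ.+_) (int-neg n))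

-- Equality in ℚₚ compares cross products of residues, so an equation in ℚ has to become one between
-- integers before it can be used there.
cross-multiply : ∀ x m n → x ℚ.* int m ≡ int n → ↥ x ℤ.* m ≡ n ℤ.* ↧ x
cross-multiply x@record{} m n eq = unnormalised (subst (λ y → ℚ.toℚᵘ y ℚᵘ.≃ ℚ.toℚᵘ x ℚᵘ.* ℚ.toℚᵘ (reduced m))
  (begin
    x ℚ.* reduced m ≡⟨ cong (x ℚ.*_) (int-reduced m) ⟨
    x ℚ.* int m     ≡⟨ eq ⟩
    int n           ≡⟨ int-reduced n ⟩
    reduced n       ∎)
  (ℚ.toℚᵘ-homo-* x (reduced m)))
  where
  open ≡-Reasoning
  unnormalised : ℚ.toℚᵘ (reduced n) ℚᵘ.≃ ℚ.toℚᵘ x ℚᵘ.* ℚ.toℚᵘ (reduced m) → ↥ x ℤ.* m ≡ n ℤ.* ↧ x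
  unnormalised (ℚᵘ.*≡* e) = begin
    ↥ x ℤ.* m                     ≡⟨ ℤ.*-identityʳ _ ⟨
    ↥ x ℤ.* m ℤ.* 1ℤ              ≡⟨ e ⟨
    n ℤ.* + (ℚ.↧ₙ x ℕ.* 1)        ≡⟨ cong (λ d → n ℤ.* + d) (ℕ.*-identityʳ (ℚ.↧ₙ x)) ⟩
    n ℤ.* ↧ x                     ∎

toℚ[i] : ℤ[i] → ℚ[i]
toℚ[i] = mapᴳ int

toℚ[i]-⊛ : ∀ z w → toℚ[i] (z ⊛ w) ≡ toℚ[i] z · toℚ[i] w
toℚ[i]-⊛ (a + b 𝐢) (c + d 𝐢) = cong₂ _+_𝐢
  (trans (int-minus (a ℤ.* c) (b ℤ.* d)) (cong₂ ℚ._-_ (int-* a c) (int-* b d)))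
  (trans (int-+ (a ℤ.* d) (b ℤ.* c)) (cong₂ ℚ._+_ (int-* a d) (int-* b c)))

toℚ[i]-⊝ : ∀ z w → toℚ[i] (z ⊕ ⊝ w) ≡ toℚ[i] z ⊖ toℚ[i] w
toℚ[i]-⊝ (a + b 𝐢) (c + d 𝐢) = cong₂ _+_𝐢 (int-minus a c) (int-minus b d)

-- Division by p-adic units.

module PAdicQuotient (p : ℕ) where
  open Local p
  open ≡-Reasoning
  open import Data.Integer.Base using (_+_; _*_; _-_; _^_)

  -- The partial sums of d⁻¹ = e (1 + pt + (pt)² + ⋯), where d e = 1 − pt.
  module _ (d e t : ℤ) (de≡1-pt : d * e ≡ 1ℤ - + p * t) where
    inverse : ℕ → ℤ
    inverse zero    = 0ℤ
    inverse (suc k) = inverse k + e * (pow k * t ^ k)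

    inverse-correct : ∀ k → d * inverse k ≡ 1ℤ - pow k * t ^ k
    inverse-correct zero    = ℤ.*-zeroʳ d
    inverse-correct (suc k) = begin
      d * (inverse k + e * (pow k * t ^ k))
        ≡⟨ expand d e (inverse k) (pow k * t ^ k) ⟩
      d * inverse k + d * e * (pow k * t ^ k)
        ≡⟨ cong₂ (λ u v → u + v * (pow k * t ^ k)) (inverse-correct k) de≡1-pt ⟩
      1ℤ - pow k * t ^ k + (1ℤ - + p * t) * (pow k * t ^ k)
        ≡⟨ telescope (+ p) t (pow k) (t ^ k) ⟩
      1ℤ - + p * pow k * (t * t ^ k)
        ≡⟨ cong (λ u → 1ℤ - u * (t * t ^ k)) (ℤ.pos-* p (p ℕ.^ k)) ⟨
      1ℤ - pow (suc k) * t ^ suc k                              ∎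
      where
      expand : ∀ d e u v → d * (u + e * v) ≡ d * u + d * e * v
      expand = solveℤ
      telescope : ∀ p t u v → 1ℤ - u * v + (1ℤ - p * t) * (u * v) ≡ 1ℤ - p * u * (t * v)
      telescope = solveℤ

    quotientₚ : ℤ → ℤₚ
    quotientₚ n .ℤₚ.residue  k = n * inverse k
    quotientₚ n .ℤₚ.coherent k = divides (n * e * t ^ k) (difference n (inverse k) e (pow k) (t ^ k))
      where
      difference : ∀ n u e v w → n * (u + e * (v * w)) - n * u ≡ n * e * w * v
      difference = solveℤ

    -- The conclusion is what a / b ≃ p · (n / d) unfolds to at level k; the factor 1 is the
    -- denominator of an element of ℤₚ.
    quotientₚ-correct : ∀ a b n → a * d ≡ + p * n * b → ∀ k →
      pow k ∣ a * 1ℤ - pow 1 * (n * inverse k) * b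
    quotientₚ-correct a b n ad≡pnb k = divides (inverse k * (+ p * n * b) * t ^ k + y * t ^ k) (begin
      a * 1ℤ - pow 1 * (n * inverse k) * b
        ≡⟨ cong (λ u → a * 1ℤ - + u * (n * inverse k) * b) (ℕ.*-identityʳ p) ⟩
      a * 1ℤ - + p * (n * inverse k) * b
        -- Both summands become multiples of 1 - d · `inverse k` = pᵏ tᵏ, the first one once a d is
        -- replaced by p n b.
        ≡⟨ expand a b n (+ p) d (inverse k) ⟩
      inverse k * (a * d - + p * n * b * (d * inverse k)) + y * (1ℤ - d * inverse k)
        ≡⟨ cong₂ (λ u v → inverse k * (u - + p * n * b * v) + y * (1ℤ - v)) ad≡pnb (inverse-correct k) ⟩
      inverse k * (+ p * n * b - + p * n * b * (1ℤ - pow k * t ^ k)) + y * (1ℤ - (1ℤ - pow k * t ^ k))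
        ≡⟨ factor (inverse k) (+ p * n * b) y (pow k) (t ^ k) ⟩
      (inverse k * (+ p * n * b) * t ^ k + y * t ^ k) * pow k
        ∎)
      where
      y = a - + p * n * b * inverse k
      expand : ∀ a b n p d u →
        a * 1ℤ - p * (n * u) * b ≡ u * (a * d - p * n * b * (d * u)) + (a - p * n * b * u) * (1ℤ - d * u)
      expand = solveℤ
      factor : ∀ u v y w x → u * (v - v * (1ℤ - w * x)) + y * (1ℤ - (1ℤ - w * x)) ≡ (u * v * x + y * x) * w
      factor = solveℤ

  -- Multiplying by the conjugate of m replaces the divisor by the norm d, a rational integer, so
  -- both coordinates of X are quotients by the same d. The norm e of m′ inverts d modulo p because
  -- the norm is multiplicative.
  scaled-in-p : {{_ : Prime p}} → ∀ X m m′ s z → m ⊛ m′ ≡ embed 1ℤ ⊕ embed (+ p) ⊛ s →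
    X · toℚ[i] m ≡ toℚ[i] (embed (+ p) ⊛ z) → X ∈p^ 1 ℤₚ[i]
  scaled-in-p X m m′ s z unit eq =
    (part (re w) + part (im w) 𝐢) , correct (re X) (re w) re-eq , correct (im X) (im w) im-eq
    where
    d = re (m ⊛ conj m)
    e = re (m′ ⊛ conj m′)
    -- Read off from the norm of 1 + p s, which is 1 + 2 p Re s + p² |s|².
    t = ℤ.- (+ 2 * re s + + p * (re s * re s + im s * im s))
    w = z ⊛ conj m

    norm-unit : d * e ≡ 1ℤ - + p * t
    norm-unit = begin
      d * e
        ≡⟨ multiplicative (re m) (im m) (re m′) (im m′) ⟩
      re ((m ⊛ m′) ⊛ conj (m ⊛ m′))                           ≡⟨ cong (λ u → re (u ⊛ conj u)) unit ⟩
      re ((embed 1ℤ ⊕ embed (+ p) ⊛ s) ⊛ conj (embed 1ℤ ⊕ embed (+ p) ⊛ s))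
                                                              ≡⟨ expand (+ p) (re s) (im s) ⟩
      1ℤ - + p * t                                            ∎
      where
      multiplicative : ∀ a b c d → (a * a - b * ℤ.- b) * (c * c - d * ℤ.- d)
        ≡ (a * c - b * d) * (a * c - b * d) - (a * d + b * c) * ℤ.- (a * d + b * c)
      multiplicative = solveℤ
      expand : ∀ p x y → (1ℤ + (p * x - 0ℤ * y)) * (1ℤ + (p * x - 0ℤ * y))
          - (0ℤ + (p * y + 0ℤ * x)) * ℤ.- (0ℤ + (p * y + 0ℤ * x))
        ≡ 1ℤ - p * ℤ.- (+ 2 * x + p * (x * x + y * y))
      expand = solveℤ

    part : ℤ → ℤₚ
    part = quotientₚ d e t norm-unit

    scaled : X · toℚ[i] (embed d) ≡ toℚ[i] (embed (+ p) ⊛ w)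
    scaled = begin
      X · toℚ[i] (embed d)
        ≡⟨ cong (λ u → X · toℚ[i] u) (norm-real (re m) (im m)) ⟩
      X · toℚ[i] (m ⊛ conj m)                  ≡⟨ cong (X ·_) (toℚ[i]-⊛ m (conj m)) ⟩
      X · (toℚ[i] m · toℚ[i] (conj m))         ≡⟨ ℚ[i].*-assoc X (toℚ[i] m) (toℚ[i] (conj m)) ⟨
      X · toℚ[i] m · toℚ[i] (conj m)           ≡⟨ cong (_· toℚ[i] (conj m)) eq ⟩
      toℚ[i] (embed (+ p) ⊛ z) · toℚ[i] (conj m) ≡⟨ toℚ[i]-⊛ (embed (+ p) ⊛ z) (conj m) ⟨
      toℚ[i] (embed (+ p) ⊛ z ⊛ conj m)
        ≡⟨ cong toℚ[i] (ℤ[i].*-assoc (embed (+ p)) z (conj m)) ⟩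
      toℚ[i] (embed (+ p) ⊛ w)                 ∎
      where
      norm-real : ∀ a b → embed (a * a - b * ℤ.- b) ≡ (a * a - b * ℤ.- b) + (a * ℤ.- b + b * a) 𝐢
      norm-real a b = cong₂ _+_𝐢 refl (vanish a b)
        where
        vanish : ∀ a b → 0ℤ ≡ a * ℤ.- b + b * a
        vanish = solveℤ

    re-eq : re X ℚ.* int d ≡ int (+ p * re w)
    re-eq = begin
      re X ℚ.* int d                              ≡⟨ real (re X) (im X) (int d) ⟨
      re X ℚ.* int d ℚ.- im X ℚ.* 0ℚ              ≡⟨ cong re scaled ⟩
      int (+ p * re w - 0ℤ * im w)                ≡⟨ cong int (ℤ.+-identityʳ (+ p * re w)) ⟩
      int (+ p * re w)                            ∎
      where
      real : ∀ a b c → a ℚ.* c ℚ.- b ℚ.* 0ℚ ≡ a ℚ.* c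
      real = solve 3 (λ a b c → a :* c :- b :* con 0ℚ := a :* c) refl
        where open +-*-Solver

    im-eq : im X ℚ.* int d ≡ int (+ p * im w)
    im-eq = begin
      im X ℚ.* int d                              ≡⟨ imaginary (re X) (im X) (int d) ⟨
      re X ℚ.* 0ℚ ℚ.+ im X ℚ.* int d              ≡⟨ cong im scaled ⟩
      int (+ p * im w + 0ℤ * re w)                ≡⟨ cong int (ℤ.+-identityʳ (+ p * im w)) ⟩
      int (+ p * im w)                            ∎
      where
      imaginary : ∀ a b c → a ℚ.* 0ℚ ℚ.+ b ℚ.* c ≡ b ℚ.* c
      imaginary = solve 3 (λ a b c → a :* con 0ℚ :+ b :* c := b :* c) refl
        where open +-*-Solver

    correct : ∀ x n → x ℚ.* int d ≡ int (+ p * n) → ℚ⇒ℚₚ x ≃ ℤₚ⇒ℚₚ (ι (pow 1) *ₚ part n)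
    correct x n xd≡pn = quotientₚ-correct d e t norm-unit (↥ x) (↧ x) n (cross-multiply x d (+ p * n) xd≡pn)

-- Finite products in ℤ[i] and their cutting into blocks.

module Product = Sum ℤ[i].*-commutativeMonoid

infix 5 Π

-- Peels off the first factor, to agree with the fold over `Fin`, whereas `∏` peels off the last
-- one; `Π-last` mediates.
Π : ℕ → (ℕ → ℤ[i]) → ℤ[i]
Π zero    f = embed 1ℤ
Π (suc n) f = f 0 ⊛ Π n (f ∘ suc)

syntax Π n (λ x → e) = Π[ x < n ] e

-- Gives access to invariance under permutations of `Fin n`, available for sums in any commutative
-- monoid, here the multiplicative one.
Π≡product : ∀ n f → Π n f ≡ Product.sum {n} (f ∘ toℕ)
Π≡product zero    f = refl
Π≡product (suc n) f = cong (f 0 ⊛_) (Π≡product n (f ∘ suc))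

Π-cong< : ∀ n {f g} → (∀ i → i < n → f i ≡ g i) → Π n f ≡ Π n g
Π-cong< zero    f≗g = refl
Π-cong< (suc n) f≗g = cong₂ _⊛_ (f≗g 0 z<s) (Π-cong< n λ i i<n → f≗g (suc i) (s<s i<n))

Π-cong : ∀ n {f g} → (∀ i → f i ≡ g i) → Π n f ≡ Π n g
Π-cong n f≗g = Π-cong< n λ i _ → f≗g i

Π-one : ∀ n {f} → (∀ i → i < n → f i ≡ embed 1ℤ) → Π n f ≡ embed 1ℤ
Π-one zero    f≗1 = refl
Π-one (suc n) f≗1 = cong₂ _⊛_ (f≗1 0 z<s) (Π-one n λ i i<n → f≗1 (suc i) (s<s i<n))

Π-distrib : ∀ n f g → (Π[ i < n ] f i ⊛ g i) ≡ Π n f ⊛ Π n g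
Π-distrib zero    f g = refl
Π-distrib (suc n) f g = trans (cong (f 0 ⊛ g 0 ⊛_) (Π-distrib n (f ∘ suc) (g ∘ suc)))
  (interchange (f 0) (g 0) (Π n (f ∘ suc)) (Π n (g ∘ suc)))
  where
  interchange : ∀ a b c d → a ⊛ b ⊛ (c ⊛ d) ≡ a ⊛ c ⊛ (b ⊛ d)
  interchange = solve-∀ ℤ[i]-ring

Π-comm : ∀ m n (f : ℕ → ℕ → ℤ[i]) → (Π[ i < m ] Π[ j < n ] f i j) ≡ (Π[ j < n ] Π[ i < m ] f i j)
Π-comm zero    n f = sym (Π-one n λ _ _ → refl)
Π-comm (suc m) n f = trans (cong (Π n (f 0) ⊛_) (Π-comm m n (f ∘ suc)))
  (sym (Π-distrib n (f 0) (λ j → Π[ i < m ] f (suc i) j)))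

Π-+ : ∀ m n f → Π (m ℕ.+ n) f ≡ Π m f ⊛ (Π[ i < n ] f (m ℕ.+ i))
Π-+ zero    n f = sym (ℤ[i].*-identityˡ _)
Π-+ (suc m) n f = trans (cong (f 0 ⊛_) (Π-+ m n (f ∘ suc))) (sym (ℤ[i].*-assoc (f 0) _ _))

Π-last : ∀ n f → Π (suc n) f ≡ Π n f ⊛ f n
Π-last zero    f = ℤ[i].*-comm (f 0) (embed 1ℤ)
Π-last (suc n) f = trans (cong (f 0 ⊛_) (Π-last n (f ∘ suc))) (sym (ℤ[i].*-assoc (f 0) _ _))

Π-reverse : ∀ n f → (Π[ i < n ] f (n ℕ.∸ suc i)) ≡ Π n f
Π-reverse zero    f = refl
Π-reverse (suc n) f = begin
  f n ⊛ (Π[ i < n ] f (n ℕ.∸ suc i)) ≡⟨ cong (f n ⊛_) (Π-reverse n f) ⟩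
  f n ⊛ Π n f                        ≡⟨ ℤ[i].*-comm (f n) (Π n f) ⟩
  Π n f ⊛ f n                        ≡⟨ Π-last n f ⟨
  Π (suc n) f                        ∎
  where open ≡-Reasoning

Π-single : ∀ {n i} f → i < n → (∀ j → j < n → j ≢ i → f j ≡ embed 1ℤ) → Π n f ≡ f i
Π-single {suc n} {zero} f _ f≗1 =
  trans (cong (f 0 ⊛_) (Π-one n λ j j<n → f≗1 (suc j) (s<s j<n) λ ())) (ℤ[i].*-identityʳ (f 0))
Π-single {suc n} {suc i} f (s<s i<n) f≗1 = begin
  f 0 ⊛ Π n (f ∘ suc)
    ≡⟨ cong₂ _⊛_ (f≗1 0 z<s λ ()) (Π-single (f ∘ suc) i<n λ j j<n j≢i → f≗1 (suc j) (s<s j<n) (j≢i ∘ ℕ.suc-injective)) ⟩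
  embed 1ℤ ⊛ f (suc i)    ≡⟨ ℤ[i].*-identityˡ (f (suc i)) ⟩
  f (suc i)               ∎
  where open ≡-Reasoning

Π-blocks : ∀ p C γ f → Π (p ℕ.* C ℕ.+ γ) f ≡
  (Π[ k < C ] Π[ j < p ] f (p ℕ.* k ℕ.+ j)) ⊛ (Π[ j < γ ] f (p ℕ.* C ℕ.+ j))
Π-blocks p C γ f = trans (Π-+ (p ℕ.* C) γ f) (cong (_⊛ (Π[ j < γ ] f (p ℕ.* C ℕ.+ j))) (full C))
  where
  open ≡-Reasoning
  full : ∀ C → Π (p ℕ.* C) f ≡ (Π[ k < C ] Π[ j < p ] f (p ℕ.* k ℕ.+ j))
  full zero    = cong (λ n → Π n f) (ℕ.*-zeroʳ p)
  full (suc C) = begin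
    Π (p ℕ.* suc C) f
      ≡⟨ cong (λ n → Π n f) (trans (ℕ.*-suc p C) (ℕ.+-comm p (p ℕ.* C))) ⟩
    Π (p ℕ.* C ℕ.+ p) f          ≡⟨ Π-+ (p ℕ.* C) p f ⟩
    Π (p ℕ.* C) f ⊛ row C        ≡⟨ cong (_⊛ row C) (full C) ⟩
    (Π[ k < C ] row k) ⊛ row C   ≡⟨ Π-last C row ⟨
    (Π[ k < suc C ] row k)       ∎
    where
    row : ℕ → ℤ[i]
    row k = Π[ j < p ] f (p ℕ.* k ℕ.+ j)

Π²-blocks : ∀ p C D γ δ (f : ℕ → ℕ → ℤ[i]) → (Π[ n < p ℕ.* C ℕ.+ γ ] Π[ m < p ℕ.* D ℕ.+ δ ] f n m) ≡
  (Π[ k < C ] Π[ l < D ] Π[ j < p ] Π[ r < p ] f (p ℕ.* k ℕ.+ j) (p ℕ.* l ℕ.+ r)) ⊛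
  (Π[ k < C ] Π[ j < p ] Π[ r < δ ] f (p ℕ.* k ℕ.+ j) (p ℕ.* D ℕ.+ r)) ⊛
  (Π[ j < γ ] Π[ l < D ] Π[ r < p ] f (p ℕ.* C ℕ.+ j) (p ℕ.* l ℕ.+ r)) ⊛
  (Π[ j < γ ] Π[ r < δ ] f (p ℕ.* C ℕ.+ j) (p ℕ.* D ℕ.+ r))
Π²-blocks p C D γ δ f = begin
  (Π[ n < p ℕ.* C ℕ.+ γ ] Π[ m < p ℕ.* D ℕ.+ δ ] f n m)
    ≡⟨ Π-cong (p ℕ.* C ℕ.+ γ) (λ n → Π-blocks p D δ (f n)) ⟩
  (Π[ n < p ℕ.* C ℕ.+ γ ] full n ⊛ rest n)
    ≡⟨ Π-distrib (p ℕ.* C ℕ.+ γ) full rest ⟩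
  Π (p ℕ.* C ℕ.+ γ) full ⊛ Π (p ℕ.* C ℕ.+ γ) rest
    ≡⟨ cong₂ _⊛_ (Π-blocks p C γ full) (Π-blocks p C γ rest) ⟩
  (Π[ k < C ] Π[ j < p ] full (p ℕ.* k ℕ.+ j)) ⊛ Π[full] ⊛ (Π[rest] ⊛ Π[corner])
    -- The indices k, l of the block move outside, the position j, r within the block stays inside.
    ≡⟨ cong (λ z → z ⊛ Π[full] ⊛ (Π[rest] ⊛ Π[corner])) (Π-cong C λ k → Π-comm p D λ j l → Π[ r < p ] f (p ℕ.* k ℕ.+ j) (p ℕ.* l ℕ.+ r)) ⟩
  Π[blocks] ⊛ Π[full] ⊛ (Π[rest] ⊛ Π[corner])
    ≡⟨ rearrange Π[blocks] Π[full] Π[rest] Π[corner] ⟩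
  Π[blocks] ⊛ Π[rest] ⊛ Π[full] ⊛ Π[corner]
    ∎
  where
  open ≡-Reasoning
  full rest : ℕ → ℤ[i]
  full n = Π[ l < D ] Π[ r < p ] f n (p ℕ.* l ℕ.+ r)
  rest n = Π[ r < δ ] f n (p ℕ.* D ℕ.+ r)
  Π[blocks] = Π[ k < C ] Π[ l < D ] Π[ j < p ] Π[ r < p ] f (p ℕ.* k ℕ.+ j) (p ℕ.* l ℕ.+ r)
  Π[full] = Π[ j < γ ] full (p ℕ.* C ℕ.+ j)
  Π[rest] = Π[ k < C ] Π[ j < p ] rest (p ℕ.* k ℕ.+ j)
  Π[corner] = Π[ j < γ ] rest (p ℕ.* C ℕ.+ j)
  rearrange : ∀ a b c d → a ⊛ b ⊛ (c ⊛ d) ≡ a ⊛ c ⊛ b ⊛ d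
  rearrange = solve-∀ ℤ[i]-ring

toℚ[i]-Π : ∀ n f → toℚ[i] (Π n f) ≡ ∏ n (toℚ[i] ∘ f)
toℚ[i]-Π zero    f = refl
toℚ[i]-Π (suc n) f = begin
  toℚ[i] (Π (suc n) f)            ≡⟨ cong toℚ[i] (Π-last n f) ⟩
  toℚ[i] (Π n f ⊛ f n)            ≡⟨ toℚ[i]-⊛ (Π n f) (f n) ⟩
  toℚ[i] (Π n f) · toℚ[i] (f n)   ≡⟨ cong (_· toℚ[i] (f n)) (toℚ[i]-Π n f) ⟩
  ∏ n (toℚ[i] ∘ f) · toℚ[i] (f n) ∎
  where open ≡-Reasoning

-- Congruence and units modulo p in ℤ[i].

module Congruence (p : ℕ) where

  infix 4 _≈_
  infix 3 _by_ _via_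

  -- The quotient is kept as data because in the end it becomes a factor of the numerator that is
  -- divided p-adically.
  record _≈_ (z w : ℤ[i]) : Set where
    constructor _by_
    field
      quotient : ℤ[i]
      equality : z ≡ w ⊕ embed (+ p) ⊛ quotient

  ≈-reflexive : ∀ {z w} → z ≡ w → z ≈ w
  ≈-reflexive {z} refl = embed 0ℤ by identity z (embed (+ p))
    where
    identity : ∀ z q → z ≡ z ⊕ q ⊛ embed 0ℤ
    identity = solve-∀ ℤ[i]-ring

  ≈-sym : ∀ {z w} → z ≈ w → w ≈ z
  ≈-sym {w = w} (t by refl) = ⊝ t by identity w (embed (+ p)) t
    where
    identity : ∀ w q t → w ≡ w ⊕ q ⊛ t ⊕ q ⊛ ⊝ t
    identity = solve-∀ ℤ[i]-ring

  ≈-trans : ∀ {z w v} → z ≈ w → w ≈ v → z ≈ v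
  ≈-trans {v = v} (s by refl) (t by refl) = t ⊕ s by identity v (embed (+ p)) s t
    where
    identity : ∀ v q s t → v ⊕ q ⊛ t ⊕ q ⊛ s ≡ v ⊕ q ⊛ (t ⊕ s)
    identity = solve-∀ ℤ[i]-ring

  ≈-setoid : Setoid 0ℓ 0ℓ
  ≈-setoid = record
    { Carrier = ℤ[i]
    ; _≈_ = _≈_
    ; isEquivalence = record { refl = ≈-reflexive refl ; sym = ≈-sym ; trans = ≈-trans }
    }

  ⊛-cong : ∀ {z z′ w w′} → z ≈ z′ → w ≈ w′ → z ⊛ w ≈ z′ ⊛ w′
  ⊛-cong {z′ = z} {w′ = w} (s by refl) (t by refl) =
    z ⊛ t ⊕ s ⊛ w ⊕ embed (+ p) ⊛ s ⊛ t by identity z w (embed (+ p)) s t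
    where
    identity : ∀ z w q s t → (z ⊕ q ⊛ s) ⊛ (w ⊕ q ⊛ t) ≡ z ⊛ w ⊕ q ⊛ (z ⊛ t ⊕ s ⊛ w ⊕ q ⊛ s ⊛ t)
    identity = solve-∀ ℤ[i]-ring

  Π-cong≈< : ∀ n {f g} → (∀ i → i < n → f i ≈ g i) → Π n f ≈ Π n g
  Π-cong≈< zero    f≈g = ≈-reflexive refl
  Π-cong≈< (suc n) f≈g = ⊛-cong (f≈g 0 z<s) (Π-cong≈< n λ i i<n → f≈g (suc i) (s<s i<n))

  Π-cong≈ : ∀ n {f g} → (∀ i → f i ≈ g i) → Π n f ≈ Π n g
  Π-cong≈ n f≈g = Π-cong≈< n λ i _ → f≈g i

  coordinatewise : ∀ {x x′ y y′} → + p ∣ x ℤ.- x′ → + p ∣ y ℤ.- y′ → (x + y 𝐢) ≈ (x′ + y′ 𝐢)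
  coordinatewise {x} {x′} {y} {y′} (divides s x-x′≡sp) (divides t y-y′≡tp) =
    (s + t 𝐢) by cong₂ _+_𝐢
      (trans (trans (shift x x′) (cong (λ u → x′ ℤ.+ u) x-x′≡sp)) (real x′ (+ p) s t))
      (trans (trans (shift y y′) (cong (λ u → y′ ℤ.+ u) y-y′≡tp)) (imaginary y′ (+ p) s t))
    where
    open import Data.Integer.Base using (_+_; _*_; _-_)
    shift : ∀ x x′ → x ≡ x′ + (x - x′)
    shift = solveℤ
    real : ∀ x p s t → x + s * p ≡ x + (p * s - 0ℤ * t)
    real = solveℤ
    imaginary : ∀ y p s t → y + t * p ≡ y + (p * t + 0ℤ * s)
    imaginary = solveℤ

  record Unit (z : ℤ[i]) : Set where
    constructor _via_
    field
      inverse : ℤ[i]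
      cancels : z ⊛ inverse ≈ embed 1ℤ

  unit-one : Unit (embed 1ℤ)
  unit-one = embed 1ℤ via ≈-reflexive refl

  unit-⊛ : ∀ {z w} → Unit z → Unit w → Unit (z ⊛ w)
  unit-⊛ {z} {w} (z′ via zz′≈1) (w′ via ww′≈1) =
    z′ ⊛ w′ via ≈-trans (≈-reflexive (interchange z w z′ w′)) (⊛-cong zz′≈1 ww′≈1)
    where
    interchange : ∀ a b c d → a ⊛ b ⊛ (c ⊛ d) ≡ a ⊛ c ⊛ (b ⊛ d)
    interchange = solve-∀ ℤ[i]-ring

  unit-Π : ∀ n {f} → (∀ i → i < n → Unit (f i)) → Unit (Π n f)
  unit-Π zero    units = unit-one
  unit-Π (suc n) units = unit-⊛ (units 0 z<s) (unit-Π n λ i i<n → units (suc i) (s<s i<n))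

  unit-resp-≈ : ∀ {z w} → z ≈ w → Unit w → Unit z
  unit-resp-≈ z≈w (w′ via ww′≈1) = w′ via ≈-trans (⊛-cong z≈w (≈-reflexive refl)) ww′≈1

-- Residues modulo a prime and their affine permutations.

module PrimeModulus (p : ℕ) (pr : Prime p) where
  open Congruence p
  open import Data.Integer.Base using (_+_; _*_; _-_; -_)

  instance
    p-nonZero : ℕ.NonZero p
    p-nonZero = prime⇒nonZero pr

  -- Bézout's identity is about natural numbers, so it is applied to |a| and the sign is moved into
  -- the inverse afterwards.
  invertible : ∀ a → ¬ (+ p ∣ a) → ∃[ b ] + p ∣ a * b - 1ℤ
  invertible a p∤a = signed (ℤ.+∣i∣≡i⊎+∣i∣≡-i a) (fromBézout (Coprimality.coprime-Bézout coprime))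
    where
    open ≡-Reasoning
    m = ℤ.∣ a ∣

    coprime : Coprime m p
    coprime (d∣a , d∣p) with prime⇒irreducible pr d∣p
    ... | inj₁ d≡1 = d≡1
    ... | inj₂ refl = contradiction (ℤ.∣ᵤ⇒∣ d∣a) p∤a

    cast : ∀ x m y n → 1 ℕ.+ y ℕ.* n ≡ x ℕ.* m → 1ℤ + + y * + n ≡ + x * + m
    cast x m y n eq = begin
      1ℤ + + y * + n      ≡⟨ cong (λ u → 1ℤ + u) (ℤ.pos-* y n) ⟨
      + (1 ℕ.+ y ℕ.* n)   ≡⟨ cong (λ u → + u) eq ⟩
      + (x ℕ.* m)         ≡⟨ ℤ.pos-* x m ⟩
      + x * + m           ∎

    fromBézout : Bézout.Identity 1 m p → ∃[ b ] + p ∣ + m * b - 1ℤ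
    fromBézout (Bézout.+- x y eq) = + x , divides (+ y) (begin
      + m * + x - 1ℤ          ≡⟨ cong (_- 1ℤ) (ℤ.*-comm (+ m) (+ x)) ⟩
      + x * + m - 1ℤ          ≡⟨ cong (_- 1ℤ) (cast x m y p eq) ⟨
      1ℤ + + y * + p - 1ℤ     ≡⟨ cancel (+ y * + p) ⟩
      + y * + p               ∎)
      where
      cancel : ∀ u → 1ℤ + u - 1ℤ ≡ u
      cancel = solveℤ
    fromBézout (Bézout.-+ x y eq) = - + x , divides (- + y) (begin
      + m * - + x - 1ℤ        ≡⟨ collect (+ m) (+ x) ⟩
      - (1ℤ + + x * + m)      ≡⟨ cong -_ (cast y p x m eq) ⟩
      - (+ y * + p)           ≡⟨ ℤ.neg-distribˡ-* (+ y) (+ p) ⟩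
      - + y * + p             ∎)
      where
      collect : ∀ m x → m * - x - 1ℤ ≡ - (1ℤ + x * m)
      collect = solveℤ

    signed : + m ≡ a ⊎ + m ≡ - a → ∃[ b ] + p ∣ + m * b - 1ℤ → ∃[ b ] + p ∣ a * b - 1ℤ
    signed (inj₁ m≡a)  (b , p∣mb-1) = b , subst (λ u → + p ∣ u * b - 1ℤ) m≡a p∣mb-1
    signed (inj₂ m≡-a) (b , p∣mb-1) = - b , subst (+ p ∣_)
      (trans (cong (λ u → u * b - 1ℤ) m≡-a) (negate a b)) p∣mb-1
      where
      negate : ∀ a b → - a * b - 1ℤ ≡ a * - b - 1ℤ
      negate = solveℤ

  residue-unique : ∀ {m n} → m < p → n < p → + p ∣ + m - + n → m ≡ n
  residue-unique {m} {n} m<p n<p p∣m-n with ℤ.∣ + m - + n ∣ in eq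
  ... | zero  = ℤ.+-injective (ℤ.i-j≡0⇒i≡j (+ m) (+ n) (ℤ.∣i∣≡0⇒i≡0 eq))
  ... | suc d = contradiction (ℕ.∣⇒≤ (subst (p ℕ.∣_) eq (ℤ.∣⇒∣ᵤ p∣m-n))) (ℕ.<⇒≱ (begin-strict
    suc d              ≡⟨ eq ⟨
    ℤ.∣ + m - + n ∣    ≡⟨ cong ℤ.∣_∣ (ℤ.m-n≡m⊖n m n) ⟩
    ℤ.∣ m ℤ.⊖ n ∣      ≤⟨ ℤ.∣m⊝n∣≤m⊔n m n ⟩
    m ℕ.⊔ n            <⟨ ℕ.⊔-lub m<p n<p ⟩
    p                  ∎))
    where open ℕ.≤-Reasoning

  n%p≡n : ∀ n → + p ∣ + (n ℤ.%ℕ p) - n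
  n%p≡n n = divides (- (n ℤ./ℕ p)) (begin
    + (n ℤ.%ℕ p) - n
      ≡⟨ cong (λ u → + (n ℤ.%ℕ p) - u) (ℤ.a≡a%ℕn+[a/ℕn]*n n p) ⟩
    + (n ℤ.%ℕ p) - (+ (n ℤ.%ℕ p) + n ℤ./ℕ p * + p)
      ≡⟨ cancel (+ (n ℤ.%ℕ p)) (n ℤ./ℕ p) (+ p) ⟩
    - (n ℤ./ℕ p) * + p                                      ∎)
    where
    open ≡-Reasoning
    cancel : ∀ r q p → r - (r + q * p) ≡ - q * p
    cancel = solveℤ

  Periodic : (ℤ → ℤ[i]) → Set
  Periodic h = ∀ {x y} → + p ∣ x - y → h x ≈ h y

  -- With t invertible, j ↦ s + t j permutes the residues, with inverse j ↦ t′ (j - s), and a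
  -- periodic h sees only residues. Scaling (s = 0) yields Fermat's theorem and the line products; t
  -- = -1 turns the descending factors of a numerator into ascending ones.
  Π-affine : ∀ {h} → Periodic h → ∀ s t t′ → + p ∣ t * t′ - 1ℤ →
    (Π[ j < p ] h (s + t * + j)) ≈ (Π[ j < p ] h (+ j))
  Π-affine {h} periodic s t t′ inv = begin
    (Π[ j < p ] h (s + t * + j))
      ≈⟨ Π-cong≈ p (λ j → ≈-sym (periodic (n%p≡n (s + t * + j)))) ⟩
    (Π[ j < p ] h (+ ((s + t * + j) ℤ.%ℕ p)))  ≡⟨ permuted ⟩
    (Π[ j < p ] h (+ j))                     ∎
    where
    open SetoidReasoning ≈-setoid

    reduce : ℤ → Fin p
    reduce n = fromℕ< (ℤ.n%ℕd<d n p)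

    toℕ-reduce : ∀ n → toℕ (reduce n) ≡ n ℤ.%ℕ p
    toℕ-reduce n = Fin.toℕ-fromℕ< (ℤ.n%ℕd<d n p)

    reduce-unique : ∀ n i → + p ∣ n - + toℕ i → reduce n ≡ i
    reduce-unique n i p∣n-i = Fin.toℕ-injective (trans (toℕ-reduce n)
      (residue-unique (ℤ.n%ℕd<d n p) (Fin.toℕ<n i)
        (subst (+ p ∣_) (chain (+ (n ℤ.%ℕ p)) n (+ toℕ i)) (ℤ.∣m∣n⇒∣m+n (n%p≡n n) p∣n-i))))
      where
      chain : ∀ a b c → a - b + (b - c) ≡ a - c
      chain = solveℤ

    to from : Fin p → Fin p
    to j = reduce (s + t * + toℕ j)
    from j = reduce (t′ * (+ toℕ j - s))

    near : ∀ n → + p ∣ + toℕ (reduce n) - n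
    near n = subst (λ m → + p ∣ + m - n) (sym (toℕ-reduce n)) (n%p≡n n)

    to-from : ∀ j → to (from j) ≡ j
    to-from j = reduce-unique (s + t * + toℕ (from j)) j (subst (+ p ∣_) (identity s t t′ (+ toℕ j) (+ toℕ (from j)))
      (ℤ.∣m∣n⇒∣m+n (ℤ.∣n⇒∣m*n t (near (t′ * (+ toℕ j - s)))) (ℤ.∣m⇒∣m*n (+ toℕ j - s) inv)))
      where
      identity : ∀ s t t′ j x → t * (x - t′ * (j - s)) + (t * t′ - 1ℤ) * (j - s) ≡ s + t * x - j
      identity = solveℤ

    from-to : ∀ j → from (to j) ≡ j
    from-to j = reduce-unique (t′ * (+ toℕ (to j) - s)) j (subst (+ p ∣_) (identity s t t′ (+ toℕ j) (+ toℕ (to j)))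
      (ℤ.∣m∣n⇒∣m+n (ℤ.∣n⇒∣m*n t′ (near (s + t * + toℕ j))) (ℤ.∣m⇒∣m*n (+ toℕ j) inv)))
      where
      identity : ∀ s t t′ j x → t′ * (x - (s + t * j)) + (t * t′ - 1ℤ) * j ≡ t′ * (x - s) - j
      identity = solveℤ

    permuted : (Π[ j < p ] h (+ ((s + t * + j) ℤ.%ℕ p))) ≡ (Π[ j < p ] h (+ j))
    permuted = ≡.begin
      (Π[ j < p ] h (+ ((s + t * + j) ℤ.%ℕ p)))             ≡.≡⟨ Π≡product p _ ⟩
      Product.sum {p} (λ i → h (+ ((s + t * + toℕ i) ℤ.%ℕ p)))
        ≡.≡⟨ Product.sum-cong-≗ {p} (λ i → cong (λ n → h (+ n)) (toℕ-reduce (s + t * + toℕ i))) ⟨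
      Product.sum {p} (λ i → h (+ toℕ (to i)))
        ≡.≡⟨ Product.sum-permute {p} {p} (λ i → h (+ toℕ i)) (permutation to from to-from from-to) ⟨
      Product.sum {p} (λ i → h (+ toℕ i))                  ≡.≡⟨ Π≡product p _ ⟨
      (Π[ j < p ] h (+ j))                                 ≡.∎
      where module ≡ = ≡-Reasoning

-- Multiples of p in ℤ[i] and Fermat's little theorem.

module Fermat (p : ℕ) (pr : Prime p) where
  open Congruence p
  open PrimeModulus p pr
  open import Data.Integer.Base using (_+_; _*_; _-_; -_)

  _^_ : ℤ[i] → ℕ → ℤ[i]
  z ^ n = Π[ _ < n ] z

  Vanishing : ℤ[i] → Set
  Vanishing z = + p ∣ re z × + p ∣ im z

  vanishing? : ∀ z → Dec (Vanishing z)
  vanishing? z = (+ p ∣? re z) ×-dec (+ p ∣? im z)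

  vanishing-resp-≈ : ∀ {z w} → z ≈ w → Vanishing w → Vanishing z
  vanishing-resp-≈ {w = a + b 𝐢} ((s + t 𝐢) by refl) (p∣a , p∣b) =
    ℤ.∣m∣n⇒∣m+n p∣a (divides s (real (+ p) s t)) , ℤ.∣m∣n⇒∣m+n p∣b (divides t (imaginary (+ p) s t))
    where
    real : ∀ p s t → p * s - 0ℤ * t ≡ s * p
    real = solveℤ
    imaginary : ∀ p s t → p * t + 0ℤ * s ≡ t * p
    imaginary = solveℤ

  ⊛-vanishing : ∀ z {w} → Vanishing w → Vanishing (z ⊛ w)
  ⊛-vanishing (a + b 𝐢) (p∣c , p∣d) =
    ℤ.∣m∣n⇒∣m-n (ℤ.∣n⇒∣m*n a p∣c) (ℤ.∣n⇒∣m*n b p∣d) , ℤ.∣m∣n⇒∣m+n (ℤ.∣n⇒∣m*n a p∣d) (ℤ.∣n⇒∣m*n b p∣c)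

  ⊛-cancelʳ : ∀ {z w v} → Unit v → z ⊛ v ≈ w ⊛ v → z ≈ w
  ⊛-cancelʳ {z} {w} {v} (v⁻¹ via vv⁻¹≈1) zv≈wv = begin
    z                 ≈⟨ undo z ⟨
    z ⊛ v ⊛ v⁻¹       ≈⟨ ⊛-cong zv≈wv (≈-reflexive refl) ⟩
    w ⊛ v ⊛ v⁻¹       ≈⟨ undo w ⟩
    w                 ∎
    where
    open SetoidReasoning ≈-setoid
    undo : ∀ z → z ⊛ v ⊛ v⁻¹ ≈ z
    undo z = begin
      z ⊛ v ⊛ v⁻¹     ≡⟨ ℤ[i].*-assoc z v v⁻¹ ⟩
      z ⊛ (v ⊛ v⁻¹)   ≈⟨ ⊛-cong (≈-reflexive {z} refl) vv⁻¹≈1 ⟩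
      z ⊛ embed 1ℤ    ≡⟨ ℤ[i].*-identityʳ z ⟩
      z               ∎

  p∤1 : ¬ (+ p ∣ 1ℤ)
  p∤1 p∣1 = ℕ.<⇒≱ (ℕ.nonTrivial⇒n>1 p {{prime⇒nonTrivial pr}}) (ℕ.∣⇒≤ (ℤ.∣⇒∣ᵤ p∣1))

  unit⇒¬vanishing : ∀ {z} → Unit z → ¬ Vanishing z
  unit⇒¬vanishing {z} (w via zw≈1) z≈0 =
    p∤1 (proj₁ (vanishing-resp-≈ (≈-sym zw≈1) (subst Vanishing (ℤ[i].*-comm w z) (⊛-vanishing w z≈0))))

  p∣0 : + p ∣ 0ℤ
  p∣0 = divides 0ℤ refl

  embed-cong : ∀ {a b} → + p ∣ a - b → embed a ≈ embed b
  embed-cong p∣a-b = coordinatewise p∣a-b p∣0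

  embed-unit : ∀ {a} → ¬ (+ p ∣ a) → Unit (embed a)
  embed-unit {a} p∤a with invertible a p∤a
  ... | b , p∣ab-1 = embed b via ≈-trans (≈-reflexive (sym (embed-* a b))) (embed-cong p∣ab-1)

  -- Multiples of p are replaced by 1, not divided by p, so that the result modulo p depends only on
  -- the residue and products of it are periodic.
  unitPart : ℤ[i] → ℤ[i]
  unitPart z with vanishing? z
  ... | yes _ = embed 1ℤ
  ... | no  _ = z

  unitPart-vanishing : ∀ {z} → Vanishing z → unitPart z ≡ embed 1ℤ
  unitPart-vanishing {z} z≈0 with vanishing? z
  ... | yes _   = refl
  ... | no  z≉0 = contradiction z≈0 z≉0

  unitPart-¬vanishing : ∀ {z} → ¬ Vanishing z → unitPart z ≡ z
  unitPart-¬vanishing {z} z≉0 with vanishing? z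
  ... | yes z≈0 = contradiction z≈0 z≉0
  ... | no  _   = refl

  unitPart-cong : ∀ {z w} → z ≈ w → unitPart z ≈ unitPart w
  unitPart-cong {z} {w} z≈w with vanishing? z | vanishing? w
  ... | yes _   | yes _   = ≈-reflexive refl
  ... | no  _   | no  _   = z≈w
  ... | yes z≈0 | no w≉0  = contradiction (vanishing-resp-≈ (≈-sym z≈w) z≈0) w≉0
  ... | no z≉0  | yes w≈0 = contradiction (vanishing-resp-≈ z≈w w≈0) z≉0

  unitPart-unit : ∀ z → (¬ Vanishing z → Unit z) → Unit (unitPart z)
  unitPart-unit z unit with vanishing? z
  ... | yes _   = unit-one
  ... | no  z≉0 = unit z≉0

  -- Multiplication by y permutes the nonzero residues.
  fermat : ∀ {y} → ¬ (+ p ∣ y) → embed y ^ p ≈ embed y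
  fermat {y} p∤y with invertible y p∤y
  ... | y′ , p∣yy′-1 = begin
    embed y ^ p               ≡⟨ Π-cong p (λ j → split j) ⟩
    (Π[ j < p ] zeroFactor j ⊛ factor j)  ≡⟨ Π-distrib p zeroFactor factor ⟩
    Π p zeroFactor ⊛ Π p factor ≡⟨ cong (_⊛ Π p factor) zero-part ⟩
    embed y ⊛ Π p factor      ≈⟨ ⊛-cong (≈-reflexive {embed y} refl) nonzero-part ⟩
    embed y ⊛ embed 1ℤ        ≡⟨ ℤ[i].*-identityʳ (embed y) ⟩
    embed y                   ∎
    where
    open SetoidReasoning ≈-setoid

    -- `Π-affine` permutes all p residues, 0 included. The p copies of y are therefore indexed by
    -- all residues: the copy at 0 survives as the result, and the others multiply to 1 after
    -- cancelling the product S of the nonzero residues.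
    zeroFactor factor : ℕ → ℤ[i]
    zeroFactor j with vanishing? (embed (+ j))
    ... | yes _ = embed y
    ... | no  _ = embed 1ℤ
    factor j with vanishing? (embed (+ j))
    ... | yes _ = embed 1ℤ
    ... | no  _ = embed y

    split : ∀ j → embed y ≡ zeroFactor j ⊛ factor j
    split j with vanishing? (embed (+ j))
    ... | yes _ = sym (ℤ[i].*-identityʳ (embed y))
    ... | no  _ = sym (ℤ[i].*-identityˡ (embed y))

    zero-part : Π p zeroFactor ≡ embed y
    zero-part = trans (Π-single zeroFactor (ℕ.>-nonZero⁻¹ p) away) at-zero
      where
      at-zero : zeroFactor 0 ≡ embed y
      at-zero with vanishing? (embed (+ 0))
      ... | yes _   = refl
      ... | no 0≉0  = contradiction (p∣0 , p∣0) 0≉0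
      away : ∀ j → j < p → j ≢ 0 → zeroFactor j ≡ embed 1ℤ
      away j j<p j≢0 with vanishing? (embed (+ j))
      ... | no  _         = refl
      ... | yes (p∣j , _) = contradiction
        (residue-unique j<p (ℕ.>-nonZero⁻¹ p) (subst (+ p ∣_) (sym (ℤ.+-identityʳ (+ j))) p∣j)) j≢0

    unitPart-scale : ∀ j → unitPart (embed (y * + j)) ≡ factor j ⊛ unitPart (embed (+ j))
    unitPart-scale j with vanishing? (embed (+ j))
    ... | yes (p∣j , _) = unitPart-vanishing (ℤ.∣n⇒∣m*n y p∣j , p∣0)
    ... | no  j≉0 = trans (unitPart-¬vanishing (λ (p∣yj , _) → j≉0 (divisor p∣yj , p∣0))) (embed-* y (+ j))
      where
      identity : ∀ y y′ j → y′ * (y * j) - j * (y * y′ - 1ℤ) ≡ j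
      identity = solveℤ
      divisor : + p ∣ y * + j → + p ∣ + j
      divisor p∣yj = subst (+ p ∣_) (identity y y′ (+ j))
        (ℤ.∣m∣n⇒∣m-n (ℤ.∣n⇒∣m*n y′ p∣yj) (ℤ.∣n⇒∣m*n (+ j) p∣yy′-1))

    S = Π[ j < p ] unitPart (embed (+ j))

    nonzero-part : Π p factor ≈ embed 1ℤ
    nonzero-part = ⊛-cancelʳ {v = S} (unit-Π p λ j _ → unitPart-unit (embed (+ j))
      λ j≉0 → embed-unit λ p∣j → j≉0 (p∣j , p∣0)) (begin
      Π p factor ⊛ S                          ≡⟨ Π-distrib p factor _ ⟨
      (Π[ j < p ] factor j ⊛ unitPart (embed (+ j)))  ≡⟨ Π-cong p unitPart-scale ⟨
      (Π[ j < p ] unitPart (embed (y * + j)))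
        ≡⟨ Π-cong p (λ j → cong (λ u → unitPart (embed u)) (ℤ.+-identityˡ (y * + j))) ⟨
      (Π[ j < p ] unitPart (embed (0ℤ + y * + j)))
        ≈⟨ Π-affine {λ x → unitPart (embed x)}
          (λ p∣x-y → unitPart-cong (embed-cong p∣x-y)) 0ℤ y y′ p∣yy′-1 ⟩
      S                                       ≡⟨ ℤ[i].*-identityˡ S ⟨
      embed 1ℤ ⊛ S                            ∎)

-- Inertness of p: what p does not divide is a unit.

module Inert (p : ℕ) (pr : Prime p) (p%4≡3 : p ℕ.% 4 ≡ 3) where
  open Congruence p
  open PrimeModulus p pr
  open Fermat p pr
  open import Data.Integer.Base using (_+_; _*_; _-_; -_)

  ^-square : ∀ z n → z ^ (n ℕ.+ n) ≡ (z ⊛ z) ^ n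
  ^-square z n = trans (Π-+ n n (λ _ → z)) (sym (Π-distrib n (λ _ → z) (λ _ → z)))

  -- Here p = 4k + 3, and h is written with k + k so that its oddness is visible to `^h-neg`.
  k h : ℕ
  k = p ℕ./ 4
  h = suc (k ℕ.+ k)

  p≡1+2h : p ≡ suc (h ℕ.+ h)
  p≡1+2h = begin
    p                             ≡⟨ ℕ.m≡m%n+[m/n]*n p 4 ⟩
    p ℕ.% 4 ℕ.+ k ℕ.* 4           ≡⟨ cong (ℕ._+ k ℕ.* 4) p%4≡3 ⟩
    3 ℕ.+ k ℕ.* 4                 ≡⟨ identity k ⟩
    suc (h ℕ.+ h)                 ∎
    where
    open ≡-Reasoning
    identity : ∀ k → 3 ℕ.+ k ℕ.* 4 ≡ suc (suc (k ℕ.+ k) ℕ.+ suc (k ℕ.+ k))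
    identity = solveℕ

  p∤2 : ¬ (+ p ∣ + 2)
  p∤2 p∣2 = ℕ.<⇒≱ (subst (2 <_) (sym p≡1+2h) (s<s (s<s (ℕ.≤-trans (s≤s z≤n) (ℕ.m≤n+m h (k ℕ.+ k))))))
    (ℕ.∣⇒≤ (ℤ.∣⇒∣ᵤ p∣2))

  -- Here p ≡ 3 (mod 4) is used: h = (p − 1) / 2 is odd.
  ^h-neg : ∀ z → (⊝ z) ^ h ≡ ⊝ (z ^ h)
  ^h-neg z = begin
    ⊝ z ⊛ (⊝ z) ^ (k ℕ.+ k)       ≡⟨ cong (⊝ z ⊛_) (^-square (⊝ z) k) ⟩
    ⊝ z ⊛ (⊝ z ⊛ ⊝ z) ^ k         ≡⟨ cong (⊝ z ⊛_) (Π-cong k λ _ → square z) ⟩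
    ⊝ z ⊛ (z ⊛ z) ^ k             ≡⟨ cong (⊝ z ⊛_) (^-square z k) ⟨
    ⊝ z ⊛ z ^ (k ℕ.+ k)           ≡⟨ out z (z ^ (k ℕ.+ k)) ⟩
    ⊝ (z ⊛ z ^ (k ℕ.+ k))         ∎
    where
    open ≡-Reasoning
    square : ∀ z → ⊝ z ⊛ ⊝ z ≡ z ⊛ z
    square = solve-∀ ℤ[i]-ring
    out : ∀ z w → ⊝ z ⊛ w ≡ ⊝ (z ⊛ w)
    out = solve-∀ ℤ[i]-ring

  ^p : ∀ z → z ^ p ≡ z ⊛ (z ⊛ z) ^ h
  ^p z = trans (cong (z ^_) p≡1+2h) (cong (z ⊛_) (^-square z h))

  -- By contraposition: if x is a unit modulo p, so is its square.
  p∣square⇒p∣ : ∀ {x} → + p ∣ x * x → + p ∣ x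
  p∣square⇒p∣ {x} p∣x² with + p ∣? x
  ... | yes p∣x = p∣x
  ... | no  p∤x = contradiction (subst Vanishing (embed-* x x) (p∣x² , p∣0))
    (unit⇒¬vanishing (unit-⊛ (embed-unit p∤x) (embed-unit p∤x)))

  double≈0 : ∀ {z} → z ≈ ⊝ z → embed (+ 2) ⊛ z ≈ embed 0ℤ
  double≈0 {z} (t by z≡-z+pt) = t by trans (twice z) (trans (cong (_⊕ z) z≡-z+pt) (cancel z (embed (+ p)) t))
    where
    twice : ∀ z → (embed 1ℤ ⊕ embed 1ℤ) ⊛ z ≡ z ⊕ z
    twice = solve-∀ ℤ[i]-ring
    cancel : ∀ z q t → ⊝ z ⊕ q ⊛ t ⊕ z ≡ embed 0ℤ ⊕ q ⊛ t
    cancel = solve-∀ ℤ[i]-ring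

  -- If x² ≡ −y², raising to the odd power h gives xy ≡ −xy by Fermat.
  sum-of-squares : ∀ {x y} → + p ∣ x * x + y * y → ¬ (+ p ∣ x) → ¬ ¬ (+ p ∣ y)
  -- From xy ≡ -xy the product 2xy vanishes, although 2, x and y are units, p being odd.
  sum-of-squares {x} {y} p∣x²+y² p∤x p∤y = unit⇒¬vanishing
    (unit-⊛ (embed-unit p∤2) (unit-⊛ (embed-unit p∤x) (embed-unit p∤y)))
    (vanishing-resp-≈ (double≈0 opposite) (p∣0 , p∣0))
    where
    open SetoidReasoning ≈-setoid
    X = embed x
    Y = embed y

    identity : ∀ x y → x * x - - (y * y) ≡ x * x + y * y
    identity = solveℤ

    squares : X ⊛ X ≈ ⊝ (Y ⊛ Y)
    squares = begin
      X ⊛ X                 ≡⟨ embed-* x x ⟨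
      embed (x * x)         ≈⟨ embed-cong (subst (+ p ∣_) (sym (identity x y)) p∣x²+y²) ⟩
      embed (- (y * y))     ≡⟨⟩
      ⊝ embed (y * y)       ≡⟨ cong ⊝_ (embed-* y y) ⟩
      ⊝ (Y ⊛ Y)             ∎

    opposite : X ⊛ Y ≈ ⊝ (X ⊛ Y)
    opposite = begin
      X ⊛ Y                         ≈⟨ ⊛-cong (fermat p∤x) (≈-reflexive {Y} refl) ⟨
      X ^ p ⊛ Y                     ≡⟨ cong (_⊛ Y) (^p X) ⟩
      X ⊛ (X ⊛ X) ^ h ⊛ Y
        ≈⟨ ⊛-cong (⊛-cong (≈-reflexive {X} refl) (Π-cong≈ h λ _ → squares)) (≈-reflexive {Y} refl) ⟩
      X ⊛ (⊝ (Y ⊛ Y)) ^ h ⊛ Y       ≡⟨ cong (λ u → X ⊛ u ⊛ Y) (^h-neg (Y ⊛ Y)) ⟩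
      X ⊛ ⊝ ((Y ⊛ Y) ^ h) ⊛ Y       ≡⟨ move X ((Y ⊛ Y) ^ h) Y ⟩
      ⊝ X ⊛ (Y ⊛ (Y ⊛ Y) ^ h)       ≡⟨ cong (⊝ X ⊛_) (^p Y) ⟨
      ⊝ X ⊛ Y ^ p                   ≈⟨ ⊛-cong (≈-reflexive {⊝ X} refl) (fermat p∤y) ⟩
      ⊝ X ⊛ Y                       ≡⟨ out X Y ⟩
      ⊝ (X ⊛ Y)                     ∎
      where
      move : ∀ x w y → x ⊛ ⊝ w ⊛ y ≡ ⊝ x ⊛ (y ⊛ w)
      move = solve-∀ ℤ[i]-ring
      out : ∀ z w → ⊝ z ⊛ w ≡ ⊝ (z ⊛ w)
      out = solve-∀ ℤ[i]-ring

  -- The inverse is the conjugate of z divided by its norm x² + y². If p divided the norm, then it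
  -- would divide both coordinates by `sum-of-squares`.
  ¬vanishing⇒unit : ∀ z → ¬ Vanishing z → Unit z
  ¬vanishing⇒unit z@(x + y 𝐢) z≉0 with invertible (x * x + y * y) p∤norm
    where
    p∤norm : ¬ (+ p ∣ x * x + y * y)
    p∤norm p∣norm with + p ∣? x
    ... | yes p∣x = z≉0 (p∣x , p∣square⇒p∣ (ℤ.∣m+n∣m⇒∣n p∣norm (ℤ.∣n⇒∣m*n x p∣x)))
    ... | no  p∤x = sum-of-squares p∣norm p∤x λ p∣y →
      p∤x (p∣square⇒p∣ (ℤ.∣m+n∣n⇒∣m p∣norm (ℤ.∣n⇒∣m*n y p∣y)))
  ... | b , p∣Nb-1 = conj z ⊛ embed b via ≈-trans (≈-reflexive (cong₂ _+_𝐢 (real x y b) (imaginary x y b))) (embed-cong p∣Nb-1)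
    where
    real : ∀ x y b → x * (x * b - - y * 0ℤ) - y * (x * 0ℤ + - y * b) ≡ (x * x + y * y) * b
    real = solveℤ
    imaginary : ∀ x y b → x * (x * 0ℤ + - y * b) + y * (x * b - - y * 0ℤ) ≡ 0ℤ
    imaginary = solveℤ

-- Factorisation of the numerator along blocks of side p.

factor : ℕ → ℕ → ℕ → ℕ → ℤ[i]
factor A B n m = (+ A ℤ.- + n) + (+ B ℤ.- + m) 𝐢

-- The numerator of ℛ A B C D; the denominator is the special case N C D C D, read backwards.
N : ℕ → ℕ → ℕ → ℕ → ℤ[i]
N A B C D = Π[ n < C ] Π[ m < D ] factor A B n m

module Factorisation (p : ℕ) (pr : Prime p) where
  open Congruence p
  open PrimeModulus p pr
  open Fermat p pr
  open import Data.Integer.Base using (_+_; _*_; _-_; -_)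

  difference : ∀ A α k j → + (p ℕ.* A ℕ.+ α) - + (p ℕ.* k ℕ.+ j) ≡ + p * (+ A - + k) + (+ α - + j)
  difference A α k j = trans
    (cong₂ (λ u v → u + + α - (v + + j)) (ℤ.pos-* p A) (ℤ.pos-* p k))
    (identity (+ p) (+ A) (+ α) (+ k) (+ j))
    where
    identity : ∀ p A α k j → p * A + α - (p * k + j) ≡ p * (A - k) + (α - j)
    identity = solveℤ

  difference-mod : ∀ A α k j → + p ∣ (+ (p ℕ.* A ℕ.+ α) - + (p ℕ.* k ℕ.+ j)) - (+ α - + j)
  difference-mod A α k j = divides (+ A - + k) (trans
    (cong (_- (+ α - + j)) (difference A α k j)) (identity (+ p) (+ A - + k) (+ α - + j)))
    where
    identity : ∀ p q r → p * q + r - r ≡ q * p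
    identity = solveℤ

  factor-mod : ∀ A B α β k l j r →
    factor (p ℕ.* A ℕ.+ α) (p ℕ.* B ℕ.+ β) (p ℕ.* k ℕ.+ j) (p ℕ.* l ℕ.+ r) ≈ factor α β j r
  factor-mod A B α β k l j r = coordinatewise (difference-mod A α k j) (difference-mod B β l r)

  p∣difference⇒≡ : ∀ A α k j → α < p → j < p → + p ∣ + (p ℕ.* A ℕ.+ α) - + (p ℕ.* k ℕ.+ j) → α ≡ j
  p∣difference⇒≡ A α k j α<p j<p p∣d = residue-unique α<p j<p
    (ℤ.∣m+n∣m⇒∣n (subst (+ p ∣_) (difference A α k j) p∣d) (ℤ.∣m⇒∣m*n (+ A - + k) ℤ.∣-refl))

  -- At position (α, β) of a block both low digits cancel; collected over all blocks, these factors
  -- rebuild `N A B C D`.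
  factor-divisible : ∀ A B α β k l →
    factor (p ℕ.* A ℕ.+ α) (p ℕ.* B ℕ.+ β) (p ℕ.* k ℕ.+ α) (p ℕ.* l ℕ.+ β) ≡ embed (+ p) ⊛ factor A B k l
  factor-divisible A B α β k l = cong₂ _+_𝐢
    (trans (difference A α k α) (real (+ p) (+ A - + k) (+ B - + l) (+ α)))
    (trans (difference B β l β) (imaginary (+ p) (+ A - + k) (+ B - + l) (+ β)))
    where
    real : ∀ p x y r → p * x + (r - r) ≡ p * x - 0ℤ * y
    real = solveℤ
    imaginary : ∀ p x y r → p * y + (r - r) ≡ p * y + 0ℤ * x
    imaginary = solveℤ

  nonunitPart : ℤ[i] → ℤ[i]
  nonunitPart z with vanishing? z
  ... | yes _ = z
  ... | no  _ = embed 1ℤ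

  nonunitPart-vanishing : ∀ {z} → Vanishing z → nonunitPart z ≡ z
  nonunitPart-vanishing {z} z≈0 with vanishing? z
  ... | yes _   = refl
  ... | no  z≉0 = contradiction z≈0 z≉0

  nonunitPart-¬vanishing : ∀ {z} → ¬ Vanishing z → nonunitPart z ≡ embed 1ℤ
  nonunitPart-¬vanishing {z} z≉0 with vanishing? z
  ... | yes z≈0 = contradiction z≈0 z≉0
  ... | no  _   = refl

  nonunitPart⊛unitPart : ∀ z → z ≡ nonunitPart z ⊛ unitPart z
  nonunitPart⊛unitPart z with vanishing? z
  ... | yes _ = sym (ℤ[i].*-identityʳ z)
  ... | no  _ = sym (ℤ[i].*-identityˡ z)

  module _ (A B α β : ℕ) where
    block : ℕ → ℕ → ℕ → ℕ → ℤ[i]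
    block k l j r = factor (p ℕ.* A ℕ.+ α) (p ℕ.* B ℕ.+ β) (p ℕ.* k ℕ.+ j) (p ℕ.* l ℕ.+ r)

    -- Only full blocks are stripped of their multiple of p. When γ ≤ α < p and δ ≤ β < p, the
    -- strips and the corner contain none, since there j < γ or r < δ keeps one coordinate nonzero
    -- modulo p. Without these bounds they may contain multiples of p, which stay in the cofactor.
    cofactor : ℕ → ℕ → ℕ → ℕ → ℤ[i]
    cofactor C D γ δ =
      (Π[ k < C ] Π[ l < D ] Π[ j < p ] Π[ r < p ] unitPart (block k l j r)) ⊛
      (Π[ k < C ] Π[ j < p ] Π[ r < δ ] block k D j r) ⊛
      (Π[ j < γ ] Π[ l < D ] Π[ r < p ] block C l j r) ⊛
      (Π[ j < γ ] Π[ r < δ ] block C D j r)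

    module _ (α<p : α < p) (β<p : β < p) where
      -- Each full p × p block contains exactly one multiple of p.
      block-product : ∀ k l → (Π[ j < p ] Π[ r < p ] block k l j r) ≡
        embed (+ p) ⊛ factor A B k l ⊛ (Π[ j < p ] Π[ r < p ] unitPart (block k l j r))
      block-product k l = begin
        (Π[ j < p ] Π[ r < p ] block k l j r)
          ≡⟨ Π-cong p (λ j → Π-cong p λ r → nonunitPart⊛unitPart (block k l j r)) ⟩
        (Π[ j < p ] Π[ r < p ] nonunitPart (block k l j r) ⊛ unitPart (block k l j r))
          ≡⟨ Π-cong p (λ j → Π-distrib p (λ r → nonunitPart (block k l j r)) (λ r → unitPart (block k l j r))) ⟩
        (Π[ j < p ] (Π[ r < p ] nonunitPart (block k l j r)) ⊛ (Π[ r < p ] unitPart (block k l j r)))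
          ≡⟨ Π-distrib p (λ j → Π[ r < p ] nonunitPart (block k l j r)) (λ j → Π[ r < p ] unitPart (block k l j r)) ⟩
        (Π[ j < p ] Π[ r < p ] nonunitPart (block k l j r)) ⊛ unitParts
          ≡⟨ cong (_⊛ unitParts) (Π-single (λ j → Π[ r < p ] nonunitPart (block k l j r)) α<p λ j j<p j≢α →
               Π-one p λ r _ → nonunitPart-¬vanishing λ (p∣re , _) → j≢α (sym (p∣difference⇒≡ A α k j α<p j<p p∣re))) ⟩
        (Π[ r < p ] nonunitPart (block k l α r)) ⊛ unitParts
          ≡⟨ cong (_⊛ unitParts) (Π-single (λ r → nonunitPart (block k l α r)) β<p λ r r<p r≢β →
               nonunitPart-¬vanishing λ (_ , p∣im) → r≢β (sym (p∣difference⇒≡ B β l r β<p r<p p∣im))) ⟩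
        nonunitPart (block k l α β) ⊛ unitParts
          ≡⟨ cong (_⊛ unitParts) (nonunitPart-vanishing divisible) ⟩
        block k l α β ⊛ unitParts
          ≡⟨ cong (_⊛ unitParts) (factor-divisible A B α β k l) ⟩
        embed (+ p) ⊛ factor A B k l ⊛ unitParts
          ∎
        where
        open ≡-Reasoning
        unitParts = Π[ j < p ] Π[ r < p ] unitPart (block k l j r)
        divisible : Vanishing (block k l α β)
        divisible = vanishing-resp-≈ (factor-mod A B α β k l α β)
          (subst (+ p ∣_) (sym (ℤ.+-inverseʳ (+ α))) p∣0 , subst (+ p ∣_) (sym (ℤ.+-inverseʳ (+ β))) p∣0)

      -- An exact identity whose power of p depends on C and D alone, so that the same power occurs
      -- in the denominator, the case A = C, B = D, α = γ, β = δ.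
      factorisation : ∀ C D γ δ → N (p ℕ.* A ℕ.+ α) (p ℕ.* B ℕ.+ β) (p ℕ.* C ℕ.+ γ) (p ℕ.* D ℕ.+ δ) ≡
        (Π[ _ < C ] Π[ _ < D ] embed (+ p)) ⊛ N A B C D ⊛ cofactor C D γ δ
      factorisation C D γ δ = begin
        N (p ℕ.* A ℕ.+ α) (p ℕ.* B ℕ.+ β) (p ℕ.* C ℕ.+ γ) (p ℕ.* D ℕ.+ δ)
          ≡⟨ Π²-blocks p C D γ δ (factor (p ℕ.* A ℕ.+ α) (p ℕ.* B ℕ.+ β)) ⟩
        (Π[ k < C ] Π[ l < D ] Π[ j < p ] Π[ r < p ] block k l j r) ⊛ rows ⊛ columns ⊛ corner
          ≡⟨ cong (λ z → z ⊛ rows ⊛ columns ⊛ corner) blocks ⟩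
        powers ⊛ N A B C D ⊛ unitParts ⊛ rows ⊛ columns ⊛ corner
          ≡⟨ reassociate (powers ⊛ N A B C D) unitParts rows columns corner ⟩
        powers ⊛ N A B C D ⊛ cofactor C D γ δ
          ∎
        where
        open ≡-Reasoning
        powers = Π[ _ < C ] Π[ _ < D ] embed (+ p)
        unitParts = Π[ k < C ] Π[ l < D ] Π[ j < p ] Π[ r < p ] unitPart (block k l j r)
        rows = Π[ k < C ] Π[ j < p ] Π[ r < δ ] block k D j r
        columns = Π[ j < γ ] Π[ l < D ] Π[ r < p ] block C l j r
        corner = Π[ j < γ ] Π[ r < δ ] block C D j r

        reassociate : ∀ a b c d e → a ⊛ b ⊛ c ⊛ d ⊛ e ≡ a ⊛ (b ⊛ c ⊛ d ⊛ e)
        reassociate = solve-∀ ℤ[i]-ring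

        Π²-distrib : (f g : ℕ → ℕ → ℤ[i]) → (Π[ k < C ] Π[ l < D ] f k l ⊛ g k l) ≡
          (Π[ k < C ] Π[ l < D ] f k l) ⊛ (Π[ k < C ] Π[ l < D ] g k l)
        Π²-distrib f g = trans (Π-cong C λ k → Π-distrib D (f k) (g k))
          (Π-distrib C (λ k → Π D (f k)) (λ k → Π D (g k)))

        blocks : (Π[ k < C ] Π[ l < D ] Π[ j < p ] Π[ r < p ] block k l j r) ≡ powers ⊛ N A B C D ⊛ unitParts
        blocks = begin
          (Π[ k < C ] Π[ l < D ] Π[ j < p ] Π[ r < p ] block k l j r)
            ≡⟨ Π-cong C (λ k → Π-cong D (block-product k)) ⟩
          (Π[ k < C ] Π[ l < D ] embed (+ p) ⊛ factor A B k l ⊛ (Π[ j < p ] Π[ r < p ] unitPart (block k l j r)))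
            ≡⟨ Π²-distrib (λ k l → embed (+ p) ⊛ factor A B k l) (λ k l → Π[ j < p ] Π[ r < p ] unitPart (block k l j r)) ⟩
          (Π[ k < C ] Π[ l < D ] embed (+ p) ⊛ factor A B k l) ⊛ unitParts
            ≡⟨ cong (_⊛ unitParts) (Π²-distrib (λ _ _ → embed (+ p)) (factor A B)) ⟩
          powers ⊛ N A B C D ⊛ unitParts
            ∎

-- The residue of the cofactor modulo p.

falling : ℕ → ℕ → ℤ[i]
falling α γ = Π[ j < γ ] embed (+ α ℤ.- + j)

module CofactorResidue (p : ℕ) (pr : Prime p) where
  open Congruence p
  open PrimeModulus p pr
  open Fermat p pr
  open Factorisation p pr
  open import Data.Integer.Base using (_+_; _*_; _-_; -_)
  open SetoidReasoning ≈-setoid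

  descend : ∀ s j → s + - 1ℤ * j ≡ s - j
  descend = solveℤ

  Π-descending : ∀ {h} → Periodic h → ∀ s → (Π[ j < p ] h (s - + j)) ≈ (Π[ j < p ] h (+ j))
  Π-descending {h} periodic s = begin
    (Π[ j < p ] h (s - + j))          ≡⟨ Π-cong p (λ j → cong h (descend s (+ j))) ⟨
    (Π[ j < p ] h (s + - 1ℤ * + j))   ≈⟨ Π-affine {h} periodic s (- 1ℤ) (- 1ℤ) (divides 0ℤ refl) ⟩
    (Π[ j < p ] h (+ j))              ∎

  -- Scaling the line through the residues by y multiplies each factor by y, and yᵖ ≡ y.
  Π-line : ∀ (L : ℤ → ℤ → ℤ[i]) → (∀ y → Periodic (λ x → L x y)) →
    (∀ x y → L (y * x) y ≡ embed y ⊛ L x 1ℤ) → ∀ s {y} → ¬ (+ p ∣ y) →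
    (Π[ j < p ] L (s - + j) y) ≈ embed y ⊛ (Π[ j < p ] L (+ j) 1ℤ)
  Π-line L periodic homogeneous s {y} p∤y = begin
    (Π[ j < p ] L (s - + j) y)                      ≈⟨ Π-descending {λ x → L x y} (periodic y) s ⟩
    (Π[ j < p ] L (+ j) y)
      ≈⟨ Π-affine {λ x → L x y} (periodic y) 0ℤ y (proj₁ y⁻¹) (proj₂ y⁻¹) ⟨
    (Π[ j < p ] L (0ℤ + y * + j) y)
      ≡⟨ Π-cong p (λ j → trans (cong (λ u → L u y) (ℤ.+-identityˡ (y * + j))) (homogeneous (+ j) y)) ⟩
    (Π[ j < p ] embed y ⊛ L (+ j) 1ℤ)
      ≡⟨ Π-distrib p (λ _ → embed y) (λ j → L (+ j) 1ℤ) ⟩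
    embed y ^ p ⊛ (Π[ j < p ] L (+ j) 1ℤ)           ≈⟨ ⊛-cong (fermat p∤y) (≈-reflexive refl) ⟩
    embed y ⊛ (Π[ j < p ] L (+ j) 1ℤ)               ∎
    where
    y⁻¹ = invertible y p∤y

  -- The constants of a horizontal line, a vertical line and a block. Only their being units will
  -- matter, not their values.
  row column full : ℤ[i]
  row = Π[ j < p ] (+ j) + 1ℤ 𝐢
  column = Π[ r < p ] 1ℤ + (+ r) 𝐢
  full = Π[ j < p ] Π[ r < p ] unitPart ((+ j) + (+ r) 𝐢)

  p∣x-x : ∀ x → + p ∣ x - x
  p∣x-x x = subst (+ p ∣_) (sym (ℤ.+-inverseʳ x)) p∣0

  row-product : ∀ s {y} → ¬ (+ p ∣ y) → (Π[ j < p ] (s - + j) + y 𝐢) ≈ embed y ⊛ row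
  row-product = Π-line (λ x y → x + y 𝐢) (λ y p∣d → coordinatewise p∣d (p∣x-x y))
    λ x y → cong₂ _+_𝐢 (real x y) (imaginary x y)
    where
    real : ∀ x y → y * x ≡ y * x - 0ℤ * 1ℤ
    real = solveℤ
    imaginary : ∀ x y → y ≡ y * 1ℤ + 0ℤ * x
    imaginary = solveℤ

  column-product : ∀ s {x} → ¬ (+ p ∣ x) → (Π[ r < p ] x + (s - + r) 𝐢) ≈ embed x ⊛ column
  column-product = Π-line (λ y x → x + y 𝐢) (λ x p∣d → coordinatewise (p∣x-x x) p∣d)
    λ y x → cong₂ _+_𝐢 (real x y) (imaginary x y)
    where
    real : ∀ x y → x ≡ x * 1ℤ - 0ℤ * y
    real = solveℤ
    imaginary : ∀ x y → x * y ≡ x * y + 0ℤ * 1ℤ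
    imaginary = solveℤ

  full-product : ∀ α β → (Π[ j < p ] Π[ r < p ] unitPart (factor α β j r)) ≈ full
  full-product α β = begin
    (Π[ j < p ] Π[ r < p ] unitPart (factor α β j r))
      ≈⟨ Π-cong≈ p (λ j → Π-descending {λ y → unitPart ((+ α - + j) + y 𝐢)}
           (λ p∣d → unitPart-cong (coordinatewise (p∣x-x (+ α - + j)) p∣d)) (+ β)) ⟩
    (Π[ j < p ] Π[ r < p ] unitPart ((+ α - + j) + (+ r) 𝐢))
      ≈⟨ Π-descending {λ x → Π[ r < p ] unitPart (x + (+ r) 𝐢)}
           (λ p∣d → Π-cong≈ p λ r → unitPart-cong (coordinatewise p∣d (p∣x-x (+ r)))) (+ α) ⟩
    full
      ∎

  p∤[α-j] : ∀ {α j} → α < p → j < α → ¬ (+ p ∣ + α - + j)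
  p∤[α-j] α<p j<α p∣α-j = ℕ.<⇒≢ j<α (sym (residue-unique α<p (ℕ.<-trans j<α α<p) p∣α-j))

  -- The part of the residue that does not see A, B, α, β and hence is shared by numerator and
  -- denominator.
  common : ℕ → ℕ → ℕ → ℕ → ℤ[i]
  common C D γ δ = (full ^ D) ^ C ⊛ (row ^ δ) ^ C ⊛ (column ^ γ) ^ D

  -- Modulo p a factor depends only on its position in the block. The bounds γ ≤ α and δ ≤ β keep α
  -- - j and β - r nonzero modulo p on the strips, as the line products require; these values
  -- multiply to the falling factorials, once per block along the strip.
  cofactor-residue : ∀ {A B α β} C D {γ δ} → α < p → β < p → γ ≤ α → δ ≤ β →
    cofactor A B α β C D γ δ ≈ common C D γ δ ⊛ (falling β δ ^ C ⊛ falling α γ ^ D ⊛ N α β γ δ)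
  cofactor-residue {A} {B} {α} {β} C D {γ} {δ} α<p β<p γ≤α δ≤β = begin
    cofactor A B α β C D γ δ
      ≈⟨ ⊛-cong (⊛-cong (⊛-cong unitParts rows) columns) corner ⟩
    (full ^ D) ^ C ⊛ (falling β δ ⊛ row ^ δ) ^ C ⊛ (falling α γ ⊛ column ^ γ) ^ D ⊛ N α β γ δ
      ≡⟨ cong₂ (λ u v → (full ^ D) ^ C ⊛ u ⊛ v ⊛ N α β γ δ)
           (Π-distrib C (λ _ → falling β δ) (λ _ → row ^ δ)) (Π-distrib D (λ _ → falling α γ) (λ _ → column ^ γ)) ⟩
    (full ^ D) ^ C ⊛ (falling β δ ^ C ⊛ (row ^ δ) ^ C) ⊛ (falling α γ ^ D ⊛ (column ^ γ) ^ D) ⊛ N α β γ δ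
      ≡⟨ rearrange ((full ^ D) ^ C) (falling β δ ^ C) ((row ^ δ) ^ C) (falling α γ ^ D) ((column ^ γ) ^ D) (N α β γ δ) ⟩
    common C D γ δ ⊛ (falling β δ ^ C ⊛ falling α γ ^ D ⊛ N α β γ δ)
      ∎
    where
    rearrange : ∀ a b c d e f → a ⊛ (b ⊛ c) ⊛ (d ⊛ e) ⊛ f ≡ a ⊛ c ⊛ e ⊛ (b ⊛ d ⊛ f)
    rearrange = solve-∀ ℤ[i]-ring

    unitParts : (Π[ k < C ] Π[ l < D ] Π[ j < p ] Π[ r < p ] unitPart (block A B α β k l j r)) ≈ (full ^ D) ^ C
    unitParts = Π-cong≈ C λ k → Π-cong≈ D λ l → begin
      (Π[ j < p ] Π[ r < p ] unitPart (block A B α β k l j r))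
        ≈⟨ Π-cong≈ p (λ j → Π-cong≈ p λ r → unitPart-cong (factor-mod A B α β k l j r)) ⟩
      (Π[ j < p ] Π[ r < p ] unitPart (factor α β j r))        ≈⟨ full-product α β ⟩
      full                                                 ∎

    rows : (Π[ k < C ] Π[ j < p ] Π[ r < δ ] block A B α β k D j r) ≈ (falling β δ ⊛ row ^ δ) ^ C
    rows = Π-cong≈ C λ k → begin
      (Π[ j < p ] Π[ r < δ ] block A B α β k D j r)
        ≈⟨ Π-cong≈ p (λ j → Π-cong≈ δ λ r → factor-mod A B α β k D j r) ⟩
      (Π[ j < p ] Π[ r < δ ] factor α β j r)          ≡⟨ Π-comm p δ (factor α β) ⟩
      (Π[ r < δ ] Π[ j < p ] factor α β j r)
        ≈⟨ Π-cong≈< δ (λ r r<δ → row-product (+ α) (p∤[α-j] β<p (ℕ.<-≤-trans r<δ δ≤β))) ⟩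
      (Π[ r < δ ] embed (+ β - + r) ⊛ row)
        ≡⟨ Π-distrib δ (λ r → embed (+ β - + r)) (λ _ → row) ⟩
      falling β δ ⊛ row ^ δ                           ∎

    columns : (Π[ j < γ ] Π[ l < D ] Π[ r < p ] block A B α β C l j r) ≈ (falling α γ ⊛ column ^ γ) ^ D
    columns = begin
      (Π[ j < γ ] Π[ l < D ] Π[ r < p ] block A B α β C l j r)
        ≡⟨ Π-comm γ D (λ j l → Π[ r < p ] block A B α β C l j r) ⟩
      (Π[ l < D ] Π[ j < γ ] Π[ r < p ] block A B α β C l j r)
        ≈⟨ Π-cong≈ D (λ l → Π-cong≈ γ λ j → Π-cong≈ p λ r → factor-mod A B α β C l j r) ⟩
      (Π[ l < D ] Π[ j < γ ] Π[ r < p ] factor α β j r)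
        ≈⟨ Π-cong≈ D (λ l → Π-cong≈< γ λ j j<γ → column-product (+ β) (p∤[α-j] α<p (ℕ.<-≤-trans j<γ γ≤α))) ⟩
      (Π[ l < D ] Π[ j < γ ] embed (+ α - + j) ⊛ column)
        ≡⟨ Π-cong D (λ l → Π-distrib γ (λ j → embed (+ α - + j)) (λ _ → column)) ⟩
      (falling α γ ⊛ column ^ γ) ^ D                           ∎

    corner : (Π[ j < γ ] Π[ r < δ ] block A B α β C D j r) ≈ N α β γ δ
    corner = Π-cong≈ γ λ j → Π-cong≈ δ λ r → factor-mod A B α β C D j r

-- The denominator's cofactor is a unit, and ℛ is p-integral.

module CofactorUnit (p : ℕ) (pr : Prime p) (p%4≡3 : p ℕ.% 4 ≡ 3) where
  open Congruence p
  open PrimeModulus p pr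
  open Fermat p pr
  open Inert p pr p%4≡3
  open Factorisation p pr
  open CofactorResidue p pr

  common-unit : ∀ C D γ δ → Unit (common C D γ δ)
  common-unit C D γ δ = unit-⊛ (unit-⊛
    (unit-Π C λ _ _ → unit-Π D λ _ _ → unit-Π p λ j _ → unit-Π p λ r _ →
      unitPart-unit ((+ j) + (+ r) 𝐢) (¬vanishing⇒unit ((+ j) + (+ r) 𝐢)))
    (unit-Π C λ _ _ → unit-Π δ λ _ _ → unit-Π p λ j _ → ¬vanishing⇒unit ((+ j) + 1ℤ 𝐢) λ (_ , p∣1) → p∤1 p∣1))
    (unit-Π D λ _ _ → unit-Π γ λ _ _ → unit-Π p λ r _ → ¬vanishing⇒unit (1ℤ + (+ r) 𝐢) λ (p∣1 , _) → p∤1 p∣1)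

  falling-unit : ∀ {γ} → γ < p → Unit (falling γ γ)
  falling-unit {γ} γ<p = unit-Π γ λ j j<γ → embed-unit (p∤[α-j] γ<p j<γ)

  N-unit : ∀ {γ δ} → γ < p → Unit (N γ δ γ δ)
  N-unit {γ} {δ} γ<p = unit-Π γ λ j j<γ → unit-Π δ λ r _ →
    ¬vanishing⇒unit (factor γ δ j r) λ (p∣re , _) → p∤[α-j] γ<p j<γ p∣re

  -- With α = γ and β = δ, as in a denominator, every factor of the residue is a unit: the
  -- factorials γ! and δ! because γ, δ < p, the rest by inertness.
  cofactor-unit : ∀ {A B} C D {γ δ} → γ < p → δ < p → Unit (cofactor A B γ δ C D γ δ)
  cofactor-unit {A} {B} C D {γ} {δ} γ<p δ<p = unit-resp-≈
    (cofactor-residue {A} {B} C D γ<p δ<p ℕ.≤-refl ℕ.≤-refl)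
    (unit-⊛ (common-unit C D γ δ) (unit-⊛
      (unit-⊛ (unit-Π C λ _ _ → falling-unit δ<p) (unit-Π D λ _ _ → falling-unit γ<p))
      (N-unit γ<p)))

  -- That is, ℛ A B C D is p-integral.
  record Integral (A B C D : ℕ) : Set where
    constructor integral
    field
      scale quotient : ℤ[i]
      scale-unit : Unit scale
      divisibility : scale ⊛ N A B C D ≡ N C D C D ⊛ quotient

  -- Division with remainder by p splits off the last digits; the equal powers of p match, and the
  -- quotients of A, B, C, D are covered by induction. The numerator's cofactor W goes into
  -- `quotient` whether or not p divides it, which may happen when A % p < C % p. Only the
  -- denominator's V joins `scale`, and there the digits coincide as `cofactor-unit` demands.
  integrality : ∀ A B C D → Integral A B C D
  integrality A B C D = <-rec (λ C → ∀ A B D → Integral A B C D) step C A B D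
    where
    step : ∀ C → (∀ {C′} → C′ < C → ∀ A B D → Integral A B C′ D) → ∀ A B D → Integral A B C D
    step zero      ih A B D = integral (embed 1ℤ) (embed 1ℤ) unit-one refl
    step C@(suc _) ih A B D = from-quotients (ih (ℕ.m/n<m C p (ℕ.nonTrivial⇒n>1 p {{prime⇒nonTrivial pr}}))
      (A ℕ./ p) (B ℕ./ p) (D ℕ./ p))
      where
      digits : ∀ n → n ≡ p ℕ.* (n ℕ./ p) ℕ.+ n ℕ.% p
      digits n = trans (ℕ.m≡m%n+[m/n]*n n p)
        (trans (ℕ.+-comm (n ℕ.% p) _) (cong (ℕ._+ n ℕ.% p) (ℕ.*-comm (n ℕ./ p) p)))

      expand : ∀ A B C D → N A B C D ≡
        (Π[ _ < C ℕ./ p ] Π[ _ < D ℕ./ p ] embed (+ p)) ⊛ N (A ℕ./ p) (B ℕ./ p) (C ℕ./ p) (D ℕ./ p) ⊛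
          cofactor (A ℕ./ p) (B ℕ./ p) (A ℕ.% p) (B ℕ.% p) (C ℕ./ p) (D ℕ./ p) (C ℕ.% p) (D ℕ.% p)
      expand A B C D = trans
        (trans (cong₂ (λ a b → N a b C D) (digits A) (digits B)) (cong₂ (N _ _) (digits C) (digits D)))
        (factorisation (A ℕ./ p) (B ℕ./ p) (A ℕ.% p) (B ℕ.% p) (ℕ.m%n<n A p) (ℕ.m%n<n B p)
          (C ℕ./ p) (D ℕ./ p) (C ℕ.% p) (D ℕ.% p))

      from-quotients : Integral (A ℕ./ p) (B ℕ./ p) (C ℕ./ p) (D ℕ./ p) → Integral A B C D
      from-quotients (integral u w u-unit uN≡Mw) = integral (u ⊛ V) (w ⊛ W) (unit-⊛ u-unit V-unit) (begin
        u ⊛ V ⊛ N A B C D           ≡⟨ cong (u ⊛ V ⊛_) (expand A B C D) ⟩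
        u ⊛ V ⊛ (P ⊛ N′ ⊛ W)        ≡⟨ collect u V P N′ W ⟩
        P ⊛ (u ⊛ N′) ⊛ V ⊛ W        ≡⟨ cong (λ z → P ⊛ z ⊛ V ⊛ W) uN≡Mw ⟩
        P ⊛ (M′ ⊛ w) ⊛ V ⊛ W        ≡⟨ redistribute P M′ w V W ⟩
        P ⊛ M′ ⊛ V ⊛ (w ⊛ W)        ≡⟨ cong (_⊛ (w ⊛ W)) (expand C D C D) ⟨
        N C D C D ⊛ (w ⊛ W)         ∎)
        where
        open ≡-Reasoning
        P = Π[ _ < C ℕ./ p ] Π[ _ < D ℕ./ p ] embed (+ p)
        N′ = N (A ℕ./ p) (B ℕ./ p) (C ℕ./ p) (D ℕ./ p)
        M′ = N (C ℕ./ p) (D ℕ./ p) (C ℕ./ p) (D ℕ./ p)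
        V = cofactor (C ℕ./ p) (D ℕ./ p) (C ℕ.% p) (D ℕ.% p) (C ℕ./ p) (D ℕ./ p) (C ℕ.% p) (D ℕ.% p)
        W = cofactor (A ℕ./ p) (B ℕ./ p) (A ℕ.% p) (B ℕ.% p) (C ℕ./ p) (D ℕ./ p) (C ℕ.% p) (D ℕ.% p)
        V-unit : Unit V
        V-unit = cofactor-unit (C ℕ./ p) (D ℕ./ p) (ℕ.m%n<n C p) (ℕ.m%n<n D p)
        collect : ∀ u v q n w → u ⊛ v ⊛ (q ⊛ n ⊛ w) ≡ q ⊛ (u ⊛ n) ⊛ v ⊛ w
        collect = solve-∀ ℤ[i]-ring
        redistribute : ∀ q m x v w → q ⊛ (m ⊛ x) ⊛ v ⊛ w ≡ q ⊛ m ⊛ v ⊛ (x ⊛ w)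
        redistribute = solve-∀ ℤ[i]-ring

-- Falling factorials and binomial coefficients.

m-n≡m∸n : ∀ {m n} → n ≤ m → + m ℤ.- + n ≡ + (m ℕ.∸ n)
m-n≡m∸n {m} {n} n≤m = trans (ℤ.m-n≡m⊖n m n) (ℤ.⊖-≥ n≤m)

falling≡P′ : ∀ {α} γ → γ ≤ α → falling α γ ≡ embed (+ (α P′ γ))
falling≡P′ zero γ≤α = refl
falling≡P′ {α} (suc γ) γ<α = begin
  falling α (suc γ)                               ≡⟨ Π-last γ _ ⟩
  falling α γ ⊛ embed (+ α ℤ.- + γ)
    ≡⟨ cong₂ _⊛_ (falling≡P′ γ (ℕ.<⇒≤ γ<α)) (cong embed (m-n≡m∸n (ℕ.<⇒≤ γ<α))) ⟩
  embed (+ (α P′ γ)) ⊛ embed (+ (α ℕ.∸ γ))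
    ≡⟨ ℤ[i].*-comm (embed (+ (α P′ γ))) (embed (+ (α ℕ.∸ γ))) ⟩
  embed (+ (α ℕ.∸ γ)) ⊛ embed (+ (α P′ γ))        ≡⟨ embed-pos-* (α ℕ.∸ γ) (α P′ γ) ⟨
  embed (+ (α P′ suc γ))                          ∎
  where open ≡-Reasoning

P′≡choose*! : ∀ {α γ} → γ ≤ α → α P′ γ ≡ (α choose γ) ℕ.* (γ P′ γ)
P′≡choose*! {α} {γ} γ≤α = begin
  α P′ γ                                          ≡⟨ ℕ.m/n*n≡m (k!∣nP′k γ≤α) ⟨
  (α P′ γ) ℕ./ γ ℕ.! ℕ.* γ ℕ.!
    -- The quotient of the falling factorial by γ! and the binomial coefficient both equal α! / (γ!
    -- (α - γ)!).
    ≡⟨ cong (ℕ._* γ ℕ.!) (trans (nC′k≡n!/k![n-k]! {α} {γ} γ≤α) (sym (nCk≡n!/k![n-k]! {α} {γ} γ≤α))) ⟩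
  (α choose γ) ℕ.* γ ℕ.!                          ≡⟨ cong ((α choose γ) ℕ.*_) (nP′n≡n! γ) ⟨
  (α choose γ) ℕ.* (γ P′ γ)                       ∎
  where
  open ≡-Reasoning
  instance _ = γ ℕ.!≢0

-- Here γ! appears as `falling γ γ`, the form in which the denominator's cofactor contains it.
falling≡choose : ∀ {α γ} → γ ≤ α → falling α γ ≡ embed (+ (α choose γ)) ⊛ falling γ γ
falling≡choose {α} {γ} γ≤α = begin
  falling α γ                                     ≡⟨ falling≡P′ γ γ≤α ⟩
  embed (+ (α P′ γ))                              ≡⟨ cong (λ n → embed (+ n)) (P′≡choose*! γ≤α) ⟩
  embed (+ ((α choose γ) ℕ.* (γ P′ γ)))           ≡⟨ embed-pos-* (α choose γ) (γ P′ γ) ⟩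
  embed (+ (α choose γ)) ⊛ embed (+ (γ P′ γ))
    ≡⟨ cong (embed (+ (α choose γ)) ⊛_) (falling≡P′ γ ℕ.≤-refl) ⟨
  embed (+ (α choose γ)) ⊛ falling γ γ            ∎
  where open ≡-Reasoning

embed-^ : ∀ c n → embed (+ (c ℕ.^ n)) ≡ (Π[ _ < n ] embed (+ c))
embed-^ c zero    = refl
embed-^ c (suc n) = trans (embed-pos-* c (c ℕ.^ n)) (cong (embed (+ c) ⊛_) (embed-^ c n))

-- ℛ as a quotient in ℚ(i), and clearing of denominators.

∏-cong : ∀ n {f g} → (∀ i → f i ≡ g i) → ∏ n f ≡ ∏ n g
∏-cong zero    f≗g = refl
∏-cong (suc n) f≗g = cong₂ _·_ (∏-cong n f≗g) (f≗g n)

toℚ[i]-Π² : ∀ C D (f : ℕ → ℕ → ℤ[i]) → toℚ[i] (Π[ n < C ] Π[ m < D ] f n m) ≡ ∏[ n < C ] ∏[ m < D ] toℚ[i] (f n m)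
toℚ[i]-Π² C D f = trans (toℚ[i]-Π C (λ n → Π D (f n))) (∏-cong C λ n → toℚ[i]-Π D (f n))

ℛ-numerator≡ : ∀ A B C D → ℛ-numerator A B C D ≡ toℚ[i] (N A B C D)
ℛ-numerator≡ A B C D = sym (trans (toℚ[i]-Π² C D (factor A B)) (∏-cong C λ n → ∏-cong D λ m →
  cong₂ _+_𝐢 (int-minus (+ A) (+ n)) (int-minus (+ B) (+ m))))

n-i≡1+[n∸1+i] : ∀ {n i} → i < n → + n ℤ.- + i ≡ + suc (n ℕ.∸ suc i)
n-i≡1+[n∸1+i] {n} {i} i<n = trans (m-n≡m∸n (ℕ.<⇒≤ i<n)) (cong +_ (ℕ.+-∸-assoc 1 i<n))

ℛ-denominator≡ : ∀ C D → ℛ-denominator C D ≡ toℚ[i] (N C D C D)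
ℛ-denominator≡ C D = sym (begin
  toℚ[i] (N C D C D)                                      ≡⟨ cong toℚ[i] reversed ⟩
  toℚ[i] (Π[ n < C ] Π[ m < D ] (+ suc n) + (+ suc m) 𝐢)
    ≡⟨ toℚ[i]-Π² C D (λ n m → (+ suc n) + (+ suc m) 𝐢) ⟩
  ℛ-denominator C D                                       ∎)
  where
  open ≡-Reasoning
  reversed : N C D C D ≡ (Π[ n < C ] Π[ m < D ] (+ suc n) + (+ suc m) 𝐢)
  reversed = begin
    N C D C D
      ≡⟨ Π-cong< C (λ n n<C → Π-cong< D λ m m<D → cong₂ _+_𝐢 (n-i≡1+[n∸1+i] n<C) (n-i≡1+[n∸1+i] m<D)) ⟩
    (Π[ n < C ] Π[ m < D ] (+ suc (C ℕ.∸ suc n)) + (+ suc (D ℕ.∸ suc m)) 𝐢)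
      ≡⟨ Π-cong C (λ n → Π-reverse D (λ m → (+ suc (C ℕ.∸ suc n)) + (+ suc m) 𝐢)) ⟩
    (Π[ n < C ] Π[ m < D ] (+ suc (C ℕ.∸ suc n)) + (+ suc m) 𝐢)
      ≡⟨ Π-reverse C (λ n → Π[ m < D ] (+ suc n) + (+ suc m) 𝐢) ⟩
    (Π[ n < C ] Π[ m < D ] (+ suc n) + (+ suc m) 𝐢)
      ∎

⁻¹-inverseˡ : ∀ z .{{_ : ℚ.NonZero (norm z)}} → z ⁻¹ · z ≡ 1ℚ + 0ℚ 𝐢
⁻¹-inverseˡ z@(a + b 𝐢) = cong₂ _+_𝐢
  (trans (real a b (ℚ.1/ norm z)) (ℚ.*-inverseˡ (norm z)))
  (imaginary a b (ℚ.1/ norm z))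
  where
  open +-*-Solver
  real : ∀ a b u → a ℚ.* u ℚ.* a ℚ.- ℚ.- b ℚ.* u ℚ.* b ≡ u ℚ.* (a ℚ.* a ℚ.+ b ℚ.* b)
  real = solve 3 (λ a b u → a :* u :* a :- :- b :* u :* b := u :* (a :* a :+ b :* b)) refl
  imaginary : ∀ a b u → a ℚ.* u ℚ.* b ℚ.+ ℚ.- b ℚ.* u ℚ.* a ≡ 0ℚ
  imaginary = solve 3 (λ a b u → a :* u :* b :+ :- b :* u :* a := con 0ℚ) refl

÷-· : ∀ w z .{{_ : ℚ.NonZero (norm z)}} → w ÷ z · z ≡ w
÷-· w z = begin
  w · z ⁻¹ · z          ≡⟨ ℚ[i].*-assoc w (z ⁻¹) z ⟩
  w · (z ⁻¹ · z)        ≡⟨ cong (w ·_) (⁻¹-inverseˡ z) ⟩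
  w · (1ℚ + 0ℚ 𝐢)       ≡⟨ ℚ[i].*-identityʳ w ⟩
  w                     ∎
  where open ≡-Reasoning

·-cancelʳ : ∀ z .{{_ : ℚ.NonZero (norm z)}} {w v} → w · z ≡ v · z → w ≡ v
·-cancelʳ z {w} {v} wz≡vz = begin
  w                     ≡⟨ undo w ⟨
  w · z · z ⁻¹          ≡⟨ cong (_· z ⁻¹) wz≡vz ⟩
  v · z · z ⁻¹          ≡⟨ undo v ⟩
  v                     ∎
  where
  open ≡-Reasoning
  undo : ∀ w → w · z · z ⁻¹ ≡ w
  undo w = begin
    w · z · z ⁻¹        ≡⟨ ℚ[i].*-assoc w z (z ⁻¹) ⟩
    w · (z · z ⁻¹)      ≡⟨ cong (w ·_) (trans (ℚ[i].*-comm z (z ⁻¹)) (⁻¹-inverseˡ z)) ⟩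
    w · (1ℚ + 0ℚ 𝐢)     ≡⟨ ℚ[i].*-identityʳ w ⟩
    w                   ∎

ℛ-denominator-· : ∀ A B C D → ℛ A B C D · toℚ[i] (N C D C D) ≡ toℚ[i] (N A B C D)
ℛ-denominator-· A B C D = begin
  ℛ A B C D · toℚ[i] (N C D C D)       ≡⟨ cong (ℛ A B C D ·_) (ℛ-denominator≡ C D) ⟨
  ℛ A B C D · ℛ-denominator C D
    ≡⟨ ÷-· (ℛ-numerator A B C D) (ℛ-denominator C D) {{ℛ-denominator-nonZero C D}} ⟩
  ℛ-numerator A B C D                  ≡⟨ ℛ-numerator≡ A B C D ⟩
  toℚ[i] (N A B C D)                   ∎
  where open ≡-Reasoning

N-cancelʳ : ∀ C D {w v} → w · toℚ[i] (N C D C D) ≡ v · toℚ[i] (N C D C D) → w ≡ v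
N-cancelʳ C D {w} {v} eq = ·-cancelʳ (ℛ-denominator C D) {{ℛ-denominator-nonZero C D}}
  (subst (λ z → w · z ≡ v · z) (sym (ℛ-denominator≡ C D)) eq)

-- The denominators are cleared by multiplying with P·M·V and M.
clear-denominators : ∀ {R R₀ r c d P M V N₀ W u w n e} →
  R · (P · M · V) ≡ P · N₀ · W → R₀ · M ≡ N₀ → r · e ≡ n → u · N₀ ≡ M · w →
  (R ⊞ neg (R₀ · r · c · d)) · (u · V · e) · (P · M · V) · M ≡ w · (W · e ⊞ neg (n · c · d · V)) · (P · M · V) · M
clear-denominators {R} {R₀} {r} {c} {d} {P} {M} {V} {N₀} {W} {u} {w} {n} {e} R-eq R₀-eq r-eq u-eq = begin
  (R ⊞ neg (R₀ · r · c · d)) · (u · V · e) · (P · M · V) · M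
    ≡⟨ expand R R₀ r c d P M V u e ⟩
  R · (P · M · V) · (u · V · e · M) ⊞ neg (R₀ · M · (r · e) · (c · d · u · V · (P · M · V)))
    ≡⟨ cong₂ (λ x y → x · (u · V · e · M) ⊞ neg (y · (c · d · u · V · (P · M · V)))) R-eq (cong₂ _·_ R₀-eq r-eq) ⟩
  P · N₀ · W · (u · V · e · M) ⊞ neg (N₀ · n · (c · d · u · V · (P · M · V)))
    ≡⟨ factor-out c d P M V N₀ W u n e ⟩
  u · N₀ · ((W · e ⊞ neg (n · c · d · V)) · (P · M · V))
    ≡⟨ cong (_· ((W · e ⊞ neg (n · c · d · V)) · (P · M · V))) u-eq ⟩
  M · w · ((W · e ⊞ neg (n · c · d · V)) · (P · M · V))
    ≡⟨ reorder M w (W · e ⊞ neg (n · c · d · V)) (P · M · V) ⟩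
  w · (W · e ⊞ neg (n · c · d · V)) · (P · M · V) · M
    ∎
  where
  open ≡-Reasoning
  expand : ∀ R R₀ r c d P M V u e → (R ⊞ neg (R₀ · r · c · d)) · (u · V · e) · (P · M · V) · M ≡
    R · (P · M · V) · (u · V · e · M) ⊞ neg (R₀ · M · (r · e) · (c · d · u · V · (P · M · V)))
  expand = solve-∀ ℚ[i]-ring
  factor-out : ∀ c d P M V N₀ W u n e →
    P · N₀ · W · (u · V · e · M) ⊞ neg (N₀ · n · (c · d · u · V · (P · M · V))) ≡
    u · N₀ · ((W · e ⊞ neg (n · c · d · V)) · (P · M · V))
  factor-out = solve-∀ ℚ[i]-ring
  reorder : ∀ a b c d → a · b · (c · d) ≡ b · c · d · a
  reorder = solve-∀ ℚ[i]-ring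

-- Stated as a property because the product P M V is known to be cancellable only through its
-- equality with a denominator of ℛ.
Cancellable : ℤ[i] → Set
Cancellable z = ∀ {x y} → x · toℚ[i] z ≡ y · toℚ[i] z → x ≡ y

-- In fractions, R - R₀ r c d = (N₀ / M) · (W / V - n c d / e) = (w / u) · q t / (V e). P and M,
-- which may contain p, are cancelled exactly; in the application the remaining denominator u V e is
-- a unit modulo p and q is p.
cleared-difference : ∀ R R₀ r P M V N₀ W u w n e c d q t →
  Cancellable (P ⊛ M ⊛ V) → Cancellable M →
  R · toℚ[i] (P ⊛ M ⊛ V) ≡ toℚ[i] (P ⊛ N₀ ⊛ W) → R₀ · toℚ[i] M ≡ toℚ[i] N₀ → r · toℚ[i] e ≡ toℚ[i] n →
  u ⊛ N₀ ≡ M ⊛ w → W ⊛ e ≡ n ⊛ c ⊛ d ⊛ V ⊕ q ⊛ t →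
  (R ⊖ R₀ · r · toℚ[i] c · toℚ[i] d) · toℚ[i] (u ⊛ V ⊛ e) ≡ toℚ[i] (q ⊛ (w ⊛ t))
cleared-difference R R₀ r P M V N₀ W u w n e c d q t cancel-PMV cancel-M R-eq R₀-eq r-eq u-eq We-eq =
  cancel-PMV (cancel-M (begin
    X · toℚ[i] (u ⊛ V ⊛ e) · toℚ[i] (P ⊛ M ⊛ V) · toℚ[i] M
      ≡⟨ cong₂ (λ y z → X · y · z · toℚ[i] M) (triple u V e) (triple P M V) ⟩
    X · (⟦ u ⟧ · ⟦ V ⟧ · ⟦ e ⟧) · (⟦ P ⟧ · ⟦ M ⟧ · ⟦ V ⟧) · ⟦ M ⟧
      ≡⟨ clear-denominators {R} {R₀} {r} {⟦ c ⟧} {⟦ d ⟧} {⟦ P ⟧} {⟦ M ⟧} {⟦ V ⟧} {⟦ N₀ ⟧} {⟦ W ⟧} {⟦ u ⟧} {⟦ w ⟧} {⟦ n ⟧} {⟦ e ⟧}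
           (trans (cong (R ·_) (sym (triple P M V))) (trans R-eq (triple P N₀ W))) R₀-eq r-eq
           (trans (sym (toℚ[i]-⊛ u N₀)) (trans (cong toℚ[i] u-eq) (toℚ[i]-⊛ M w))) ⟩
    ⟦ w ⟧ · (⟦ W ⟧ · ⟦ e ⟧ ⊞ neg (⟦ n ⟧ · ⟦ c ⟧ · ⟦ d ⟧ · ⟦ V ⟧)) · (⟦ P ⟧ · ⟦ M ⟧ · ⟦ V ⟧) · ⟦ M ⟧
      ≡⟨ cong₂ (λ y z → y · z · ⟦ M ⟧) remainder (sym (triple P M V)) ⟩
    toℚ[i] (q ⊛ (w ⊛ t)) · toℚ[i] (P ⊛ M ⊛ V) · toℚ[i] M
      ∎))
  where
  open ≡-Reasoning
  ⟦_⟧ = toℚ[i]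
  X = R ⊖ R₀ · r · ⟦ c ⟧ · ⟦ d ⟧
  triple : ∀ x y z → toℚ[i] (x ⊛ y ⊛ z) ≡ toℚ[i] x · toℚ[i] y · toℚ[i] z
  triple x y z = trans (toℚ[i]-⊛ (x ⊛ y) z) (cong (_· toℚ[i] z) (toℚ[i]-⊛ x y))
  collect : ∀ w v q t → w ⊛ (v ⊕ q ⊛ t ⊕ ⊝ v) ≡ q ⊛ (w ⊛ t)
  collect = solve-∀ ℤ[i]-ring
  remainder : ⟦ w ⟧ · (⟦ W ⟧ · ⟦ e ⟧ ⊞ neg (⟦ n ⟧ · ⟦ c ⟧ · ⟦ d ⟧ · ⟦ V ⟧)) ≡ toℚ[i] (q ⊛ (w ⊛ t))
  remainder = begin
    ⟦ w ⟧ · (⟦ W ⟧ · ⟦ e ⟧ ⊖ ⟦ n ⟧ · ⟦ c ⟧ · ⟦ d ⟧ · ⟦ V ⟧)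
      ≡⟨ cong₂ (λ y z → ⟦ w ⟧ · (y ⊖ z)) (toℚ[i]-⊛ W e)
           (trans (toℚ[i]-⊛ (n ⊛ c ⊛ d) V) (cong (_· ⟦ V ⟧) (triple n c d))) ⟨
    ⟦ w ⟧ · (toℚ[i] (W ⊛ e) ⊖ toℚ[i] (n ⊛ c ⊛ d ⊛ V))
      ≡⟨ cong (⟦ w ⟧ ·_) (toℚ[i]-⊝ (W ⊛ e) (n ⊛ c ⊛ d ⊛ V)) ⟨
    ⟦ w ⟧ · toℚ[i] (W ⊛ e ⊕ ⊝ (n ⊛ c ⊛ d ⊛ V))
      ≡⟨ toℚ[i]-⊛ w (W ⊛ e ⊕ ⊝ (n ⊛ c ⊛ d ⊛ V)) ⟨
    toℚ[i] (w ⊛ (W ⊛ e ⊕ ⊝ (n ⊛ c ⊛ d ⊛ V)))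
      ≡⟨ cong (λ y → toℚ[i] (w ⊛ (y ⊕ ⊝ (n ⊛ c ⊛ d ⊛ V)))) We-eq ⟩
    toℚ[i] (w ⊛ (n ⊛ c ⊛ d ⊛ V ⊕ q ⊛ t ⊕ ⊝ (n ⊛ c ⊛ d ⊛ V)))
      ≡⟨ cong toℚ[i] (collect w (n ⊛ c ⊛ d ⊛ V) q t) ⟩
    toℚ[i] (q ⊛ (w ⊛ t))
      ∎

-- Comparison of the two cofactors and assembly of the congruence.

module Conclusion (p : ℕ) (pr : Prime p) (p%4≡3 : p ℕ.% 4 ≡ 3) where
  open Congruence p
  open Fermat p pr using (_^_)
  open Factorisation p pr
  open CofactorResidue p pr
  open CofactorUnit p pr p%4≡3
  open PAdicQuotient p

  binomial : ℕ → ℕ → ℕ → ℤ[i]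
  binomial α γ n = embed (+ ((α choose γ) ℕ.^ n))

  falling-^ : ∀ {α γ} n → γ ≤ α → falling α γ ^ n ≡ binomial α γ n ⊛ falling γ γ ^ n
  falling-^ {α} {γ} n γ≤α = begin
    falling α γ ^ n
      ≡⟨ Π-cong n (λ _ → falling≡choose γ≤α) ⟩
    (embed (+ (α choose γ)) ⊛ falling γ γ) ^ n
      ≡⟨ Π-distrib n (λ _ → embed (+ (α choose γ))) (λ _ → falling γ γ) ⟩
    embed (+ (α choose γ)) ^ n ⊛ falling γ γ ^ n
      ≡⟨ cong (_⊛ falling γ γ ^ n) (embed-^ (α choose γ) n) ⟨
    binomial α γ n ⊛ falling γ γ ^ n                         ∎
    where open ≡-Reasoning

  -- The statement W / V ≡ (n / e) · binomials, cross-multiplied. Nothing is inverted: after the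
  -- binomials are split off, the common constants, the factorials and e are reassembled into V by
  -- reading `cofactor-residue` backwards for the denominator.
  cofactor-ratio : ∀ A B C D {α β γ δ} → α < p → β < p → γ ≤ α → δ ≤ β →
    cofactor A B α β C D γ δ ⊛ N γ δ γ δ ≈
    N α β γ δ ⊛ binomial α γ D ⊛ binomial β δ C ⊛ cofactor C D γ δ C D γ δ
  cofactor-ratio A B C D {α} {β} {γ} {δ} α<p β<p γ≤α δ≤β = begin
    cofactor A B α β C D γ δ ⊛ N γ δ γ δ
      ≈⟨ ⊛-cong (cofactor-residue {A} {B} C D α<p β<p γ≤α δ≤β) (≈-reflexive refl) ⟩
    T ⊛ (falling β δ ^ C ⊛ falling α γ ^ D ⊛ N α β γ δ) ⊛ N γ δ γ δ
      ≡⟨ cong₂ (λ x y → T ⊛ (x ⊛ y ⊛ N α β γ δ) ⊛ N γ δ γ δ) (falling-^ C δ≤β) (falling-^ D γ≤α) ⟩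
    T ⊛ (binomial β δ C ⊛ falling δ δ ^ C ⊛ (binomial α γ D ⊛ falling γ γ ^ D) ⊛ N α β γ δ) ⊛ N γ δ γ δ
      ≡⟨ rearrange T (binomial β δ C) (falling δ δ ^ C) (binomial α γ D) (falling γ γ ^ D) (N α β γ δ) (N γ δ γ δ) ⟩
    N α β γ δ ⊛ binomial α γ D ⊛ binomial β δ C ⊛ (T ⊛ (falling δ δ ^ C ⊛ falling γ γ ^ D ⊛ N γ δ γ δ))
      ≈⟨ ⊛-cong (≈-reflexive {N α β γ δ ⊛ binomial α γ D ⊛ binomial β δ C} refl)
           (cofactor-residue {C} {D} C D (ℕ.≤-<-trans γ≤α α<p) (ℕ.≤-<-trans δ≤β β<p) ℕ.≤-refl ℕ.≤-refl) ⟨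
    N α β γ δ ⊛ binomial α γ D ⊛ binomial β δ C ⊛ cofactor C D γ δ C D γ δ
      ∎
    where
    open SetoidReasoning ≈-setoid
    T = common C D γ δ
    rearrange : ∀ t b f a g n e → t ⊛ (b ⊛ f ⊛ (a ⊛ g) ⊛ n) ⊛ e ≡ n ⊛ a ⊛ b ⊛ (t ⊛ (f ⊛ g ⊛ e))
    rearrange = solve-∀ ℤ[i]-ring

  conclusion : ∀ A B C D α β γ δ → γ ≤ α → α < p → δ ≤ β → β < p →
    Local._∈p^_ℤₚ[i] p {{pr}} (ℛ (p ℕ.* A ℕ.+ α) (p ℕ.* B ℕ.+ β) (p ℕ.* C ℕ.+ γ) (p ℕ.* D ℕ.+ δ)
      ⊖ ℛ A B C D · ℛ α β γ δ · fromℕ ((α choose γ) ℕ.^ D) · fromℕ ((β choose δ) ℕ.^ C)) 1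
  conclusion A B C D α β γ δ γ≤α α<p δ≤β β<p = assemble (integrality A B C D) (cofactor-ratio A B C D α<p β<p γ≤α δ≤β)
    where
    γ<p = ℕ.≤-<-trans γ≤α α<p
    δ<p = ℕ.≤-<-trans δ≤β β<p
    P = Π[ _ < C ] Π[ _ < D ] embed (+ p)
    M = N C D C D
    V = cofactor C D γ δ C D γ δ
    W = cofactor A B α β C D γ δ
    e = N γ δ γ δ
    n = N α β γ δ
    X = ℛ (p ℕ.* A ℕ.+ α) (p ℕ.* B ℕ.+ β) (p ℕ.* C ℕ.+ γ) (p ℕ.* D ℕ.+ δ)
      ⊖ ℛ A B C D · ℛ α β γ δ · fromℕ ((α choose γ) ℕ.^ D) · fromℕ ((β choose δ) ℕ.^ C)

    numerator : N (p ℕ.* A ℕ.+ α) (p ℕ.* B ℕ.+ β) (p ℕ.* C ℕ.+ γ) (p ℕ.* D ℕ.+ δ) ≡ P ⊛ N A B C D ⊛ W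
    numerator = factorisation A B α β α<p β<p C D γ δ

    denominator : N (p ℕ.* C ℕ.+ γ) (p ℕ.* D ℕ.+ δ) (p ℕ.* C ℕ.+ γ) (p ℕ.* D ℕ.+ δ) ≡ P ⊛ M ⊛ V
    denominator = factorisation C D γ δ γ<p δ<p C D γ δ

    finish : ∀ u w t → Unit (u ⊛ V ⊛ e) → X · toℚ[i] (u ⊛ V ⊛ e) ≡ toℚ[i] (embed (+ p) ⊛ (w ⊛ t)) →
      Local._∈p^_ℤₚ[i] p {{pr}} X 1
    finish u w t (m′ via (s by unit)) eq = scaled-in-p {{pr}} X (u ⊛ V ⊛ e) m′ s (w ⊛ t) unit eq

    assemble : Integral A B C D → W ⊛ e ≈ n ⊛ binomial α γ D ⊛ binomial β δ C ⊛ V → Local._∈p^_ℤₚ[i] p {{pr}} X 1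
    assemble (integral u w u-unit uN≡Mw) (t by We≡) = finish u w t
      (unit-⊛ (unit-⊛ u-unit (cofactor-unit {C} {D} C D γ<p δ<p)) (N-unit γ<p))
      (cleared-difference (ℛ (p ℕ.* A ℕ.+ α) (p ℕ.* B ℕ.+ β) (p ℕ.* C ℕ.+ γ) (p ℕ.* D ℕ.+ δ)) (ℛ A B C D) (ℛ α β γ δ)
        P M V (N A B C D) W u w n e (binomial α γ D) (binomial β δ C) (embed (+ p)) t
        (λ {x} {y} eq → N-cancelʳ (p ℕ.* C ℕ.+ γ) (p ℕ.* D ℕ.+ δ)
          (subst (λ z → x · toℚ[i] z ≡ y · toℚ[i] z) (sym denominator) eq))
        (N-cancelʳ C D)
        (trans (cong (λ z → ℛ (p ℕ.* A ℕ.+ α) (p ℕ.* B ℕ.+ β) (p ℕ.* C ℕ.+ γ) (p ℕ.* D ℕ.+ δ) · toℚ[i] z) (sym denominator))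
          (trans (ℛ-denominator-· (p ℕ.* A ℕ.+ α) (p ℕ.* B ℕ.+ β) (p ℕ.* C ℕ.+ γ) (p ℕ.* D ℕ.+ δ)) (cong toℚ[i] numerator)))
        (ℛ-denominator-· A B C D) (ℛ-denominator-· α β γ δ) uN≡Mw We≡)

open import Data.Nat.Base using (ℕ; _+_; _*_; _∸_; _^_; _%_; _≤_)

theorem1p3 : (p : ℕ) {{_ : Prime p}} → p % 4 ≡ 3 →
    (A B C D : ℕ) → 1 ≤ C → C ≤ A → 1 ≤ D → D ≤ B →
    (α β γ δ : ℕ) →
    1 ≤ γ → γ ≤ α → α ≤ p ∸ 1 →
    1 ≤ δ → δ ≤ β → β ≤ p ∸ 1 →
    ℛ (p * A + α) (p * B + β) (p * C + γ) (p * D + δ)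
    ≡ ℛ A B C D · ℛ α β γ δ · fromℕ ((α choose γ) ^ D) · fromℕ ((β choose δ) ^ C) [mod p ^ 1 ]
theorem1p3 p {{pr}} p%4≡3 A B C D _ _ _ _ α β γ δ _ γ≤α α≤p-1 _ δ≤β β≤p-1 =
  conclusion A B C D α β γ δ γ≤α (below α≤p-1) δ≤β (below β≤p-1)
  where
  open Conclusion p pr p%4≡3
  below : ∀ {n} → n ≤ p ∸ 1 → n < p
  below = ℕ.m≤pred[n]⇒suc[m]≤n {{prime⇒nonZero pr}}
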